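{- Let $m_1,m_2,n,D$ be positive integers such that $6m_1\log n<m_2$ and $16Dm_2\leqslant n$, and assume that $n$ is sufficiently large. Let $H$ be a graph on $n$ vertices such that $H$ is (1) a weak $(m_1,n/32D)$-expander, and (2) a weak $(m_2,m_2)$-expander. Then $H$ contains every tree $T\in\mathcal{T}(n-m_1,D)$ with at least $24Dm_2$ leaves.
   Context: For a graph $H$ and disjoint $X,Y\subseteq V(H)$, $e(X,Y)$ denotes the number of edges with one endpoint in $X$ and the other in $Y$. A graph $H$ is a weak $(a,b)$-expander if $e(X,Y)>0$ for all disjoint sets $X,Y\subseteq V(H)$ with $|X|=a$ and $|Y|=b$. $\mathcal{T}(k,D)$ denotes the class of all trees with $k$ edges and maximum degree at most $D$. "Contains" means contains as a (not necessarily induced) subgraph. -}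

module Defs where

open import Data.Nat using (ℕ; zero; suc; _+_; _*_; _∸_; _^_; _≤_; _<_; _/_; _!)
open import Data.Nat.Combinatorics using (_P_)
open import Data.Nat.ListAction using (sum)
open import Data.List using (map; upTo)
open import Data.Bool using (Bool; true; false)
open import Data.Fin using (Fin; zero; suc; inject₁; fromℕ)
open import Data.Fin.Subset using (Subset; _∈_; _∉_; ∣_∣)
open import Data.Vec using (tabulate)
open import Data.Product using (Σ; ∃; _×_; _,_)
open import Relation.Binary.PropositionalEquality using (_≡_)
open import Relation.Nullary using (¬_)
open import Function.Definitions using (Injective)

record Graph (V : ℕ) : Set where
  field
    adj    : Fin V → Fin V → Bool
    sym    : ∀ u v → adj u v ≡ adj v u
    irrefl : ∀ v → adj v v ≡ false
open Graph public

module _ {V : ℕ} (G : Graph V) where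

  nbhd : Fin V → Subset V
  nbhd v = tabulate (adj G v)

  degree : Fin V → ℕ
  degree v = ∣ nbhd v ∣

  isOne : ℕ → Bool
  isOne (suc zero) = true
  isOne _          = false

  leaves : ℕ
  leaves = ∣ tabulate (λ v → isOne (degree v)) ∣

  MaxDegreeAtMost : ℕ → Set
  MaxDegreeAtMost D = ∀ v → degree v ≤ D

  data Walk : Fin V → Fin V → Set where
    here : ∀ {u} → Walk u u
    step : ∀ {u w v} → adj G u w ≡ true → Walk w v → Walk u v

  Connected : Set
  Connected = ∀ u v → Walk u v

  record Cycle : Set where
    field
      l      : ℕ
      c      : Fin (suc (suc (suc l))) → Fin V
      inj    : Injective _≡_ _≡_ c
      consec : ∀ (i : Fin (suc (suc l))) → adj G (c (inject₁ i)) (c (suc i)) ≡ true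
      close  : adj G (c (fromℕ (suc (suc l)))) (c zero) ≡ true

  Acyclic : Set
  Acyclic = ¬ Cycle

  IsTree : Set
  IsTree = Connected × Acyclic

  WeakExpander : ℕ → ℕ → Set
  WeakExpander a b =
    ∀ (X Y : Subset V) → (∀ i → i ∈ X → i ∉ Y) → ∣ X ∣ ≡ a → ∣ Y ∣ ≡ b →
    Σ (Fin V) λ x → Σ (Fin V) λ y → x ∈ X × y ∈ Y × adj G x y ≡ true

Contains : ∀ {n k} → Graph n → Graph k → Set
Contains {n} {k} H T =
  Σ (Fin k → Fin n) λ φ → Injective _≡_ _≡_ φ ×
    (∀ u v → adj T u v ≡ true → adj H (φ u) (φ v) ≡ true)

-- Trees with k edges (hence k+1 vertices) and maximum degree ≤ D,
-- with at least L leaves.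
TreeIn𝒯 : (k D : ℕ) → Graph (suc k) → Set
TreeIn𝒯 k D T = IsTree T × MaxDegreeAtMost T D

ceilDiv : ℕ → ℕ → ℕ
ceilDiv a b' = (a + b') / suc b'

-- expScaled x K = K! · Σ_{j=0}^{K} x^j / j!  =  Σ_{j=0}^{K} x^j · K!/(j!)
expScaled : ℕ → ℕ → ℕ
expScaled x K = sum (map (λ j → x ^ j * (K P (K ∸ j))) (upTo (suc K)))

-- LogCond m₁ m₂ n  ⟺  6 m₁ ln n < m₂  (for n ≥ 1)
-- ⟺ n^(6 m₁) < e^(m₂) ⟺ some Taylor partial sum of e^(m₂) exceeds n^(6 m₁).
LogCond : ℕ → ℕ → ℕ → Set
LogCond m₁ m₂ n = ∃ λ K → n ^ (6 * m₁) * K ! < expScaled m₂ K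

{-# OPTIONS --safe #-}
module Submission where

-- A greedy derandomisation of the union bound over all m₁-sets (this is where 6 m₁ log n < m₂ enters) gives
-- a set W of 6Dm₂ vertices such that every m₁-set X misses, i.e. neither contains nor sees, fewer than m₂
-- vertices of W. Choose a set P₀ of 2m₂ parents of leaves. The inner vertices of T are embedded one by one
-- with the Friedman–Pippenger method, simultaneously in two colours: P₀ goes into W and the other inner
-- vertices avoid W; for this the fewer than 2m₁ vertices lying in small non-expanding sets are set aside.
-- Finally the leaves are attached by Hall's theorem. Sets of at most 2m₂ parents satisfy Hall's condition by the
-- Friedman–Pippenger invariant. For larger sets Z, let X be the set of unused vertices not seen by Z. The graph H
-- has m₁ − 1 vertices more than T, so |X| < m₁ is harmless; otherwise |X| < m₂ by the second expansion property,
-- and since P₀ lies in W, at least m₂ parents lie outside Z, which compensates for X.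

open import Defs renaming (sym to adj-sym)
open import Data.Nat
open import Data.Nat.Properties
open import Data.Nat.Combinatorics using (_P_)
open import Data.Nat.Combinatorics.Base using (_P′_)
open import Data.Nat.DivMod using (m/n*n≤m)
open import Data.Nat.Tactic.RingSolver using (solve-∀)
import Data.Nat.ListAction as List
import Data.Nat.ListAction.Properties as List
open import Data.Bool using (Bool; true; false; _∧_; _∨_; not; if_then_else_) renaming (T to IsTrue)
open import Data.Fin using (Fin; zero; suc; inject₁; fromℕ)
open import Data.Fin.Properties using () renaming (_≟_ to _≟ᶠ_)
open import Data.Fin.Subset using (∣_∣) renaming (_∈_ to _∈ˢ_)
open import Data.Fin.Subset.Properties using (anySubset?)
import Data.Vec as Vec
open import Data.Vec using (tabulate)
open import Data.Vec.Properties using (lookup∘tabulate; []=⇒lookup)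
open import Data.List using (List; []; _∷_; map; filter; length; lookup; upTo; allFin; cartesianProductWith)
open import Data.List.Properties using (upTo-∷ʳ; map-++; length-map; length-filter; length-++; length-tabulate)
open import Data.List.Membership.Propositional using () renaming (_∈_ to _∈ˡ_)
open import Data.List.Membership.Propositional.Properties
  using (∈-filter⁺; ∈-map⁺; ∈-allFin; ∈-lookup; ∈-cartesianProductWith⁺)
open import Data.List.Relation.Unary.Any using (here; there; any?)
open import Data.List.Relation.Unary.All using (All; []; _∷_)
import Data.List.Relation.Unary.All as All
import Data.List.Relation.Unary.All.Properties as All
open import Data.List.Relation.Unary.AllPairs using ([]; _∷_)
open import Data.List.Relation.Unary.Unique.Propositional using (Unique)
open import Data.Unit using (⊤; tt)
open import Data.Empty using (⊥; ⊥-elim)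
open import Data.Product using (Σ; ∃; _×_; _,_; proj₁; proj₂)
open import Data.Sum using (_⊎_; inj₁; inj₂; [_,_]′)
open import Function using (_∘_)
open import Relation.Nullary using (¬_; Dec; yes; no; ⌊_⌋)
open import Relation.Nullary.Decidable using (¬?; decidable-stable; _→-dec_)
open import Relation.Binary.PropositionalEquality
import Algebra.Properties.Semiring.Sum +-*-semiring as Sum

-- Finite sets and weighted sums

-- The certificate B + a ≡ A + b + c is a semiring identity, so no subtraction occurs.
linear : ∀ {A B a b} c → a ≤ b → B + a ≡ A + b + c → A ≤ B
linear {A} {B} {a} {b} c a≤b eq = +-cancelʳ-≤ b A B (begin
  A + b      ≤⟨ m≤m+n (A + b) c ⟩
  A + b + c  ≡⟨ eq ⟨
  B + a      ≤⟨ +-monoʳ-≤ B a≤b ⟩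
  B + b      ∎)
  where open ≤-Reasoning

infixr 7 _⊕_
_⊕_ : ∀ {a b c d} → a ≤ b → c ≤ d → a + c ≤ b + d
_⊕_ = +-mono-≤

opaque

  sum : ∀ {n} → (Fin n → ℕ) → ℕ
  sum = Sum.sum

  sum-cong : ∀ {n} {f g : Fin n → ℕ} → (∀ i → f i ≡ g i) → sum f ≡ sum g
  sum-cong = Sum.sum-cong-≗

  sum-+ : ∀ {n} (f g : Fin n → ℕ) → sum (λ i → f i + g i) ≡ sum f + sum g
  sum-+ = Sum.∑-distrib-+

  sum-* : ∀ {n} k (f : Fin n → ℕ) → sum (λ i → k * f i) ≡ k * sum f
  sum-* k f = sym (Sum.*-distribˡ-sum k f)

  sum-swap : ∀ {m n} (f : Fin m → Fin n → ℕ) → sum (λ i → sum (f i)) ≡ sum (λ j → sum λ i → f i j)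
  sum-swap = Sum.∑-comm

  sum-mono : ∀ {n} {f g : Fin n → ℕ} → (∀ i → f i ≤ g i) → sum f ≤ sum g
  sum-mono {zero}  h = z≤n
  sum-mono {suc n} h = +-mono-≤ (h zero) (sum-mono (h ∘ suc))

  sum-zero : ∀ {n} {f : Fin n → ℕ} → (∀ i → f i ≡ 0) → sum f ≡ 0
  sum-zero {zero}  h = refl
  sum-zero {suc n} h = cong₂ _+_ (h zero) (sum-zero (h ∘ suc))

  term≤sum : ∀ {n} (f : Fin n → ℕ) i → f i ≤ sum f
  term≤sum f zero    = m≤m+n _ _
  term≤sum f (suc i) = ≤-trans (term≤sum (f ∘ suc) i) (m≤n+m _ _)

∧-elim : ∀ {a b} → a ∧ b ≡ true → a ≡ true × b ≡ true
∧-elim {true} {true} _ = refl , refl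

∧-intro : ∀ {a b} → a ≡ true → b ≡ true → a ∧ b ≡ true
∧-intro refl refl = refl

∨-elim : ∀ {a b} → a ∨ b ≡ true → a ≡ true ⊎ b ≡ true
∨-elim {true}  _ = inj₁ refl
∨-elim {false} p = inj₂ p

∨-introˡ : ∀ {a b} → a ≡ true → a ∨ b ≡ true
∨-introˡ refl = refl

∨-introʳ : ∀ {a b} → b ≡ true → a ∨ b ≡ true
∨-introʳ {true}  refl = refl
∨-introʳ {false} refl = refl

not-intro : ∀ {a} → a ≡ false → not a ≡ true
not-intro refl = refl

not-elim : ∀ {a} → not a ≡ true → a ≡ false
not-elim {false} _ = refl

true≢false : ∀ {a} {A : Set} → a ≡ true → a ≡ false → A
true≢false refl ()

≡false : ∀ {a} → (a ≡ true → ⊥) → a ≡ false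
≡false {true}  h = ⊥-elim (h refl)
≡false {false} h = refl

bool : ∀ a → a ≡ true ⊎ a ≡ false
bool true  = inj₁ refl
bool false = inj₂ refl

opaque

  _==_ : ∀ {n} → Fin n → Fin n → Bool
  i == j = ⌊ i ≟ᶠ j ⌋

  ==-elim : ∀ {n} {i j : Fin n} → i == j ≡ true → i ≡ j
  ==-elim {i = i} {j} p with i ≟ᶠ j
  ... | yes q = q

  ==-refl : ∀ {n} (i : Fin n) → i == i ≡ true
  ==-refl i with i ≟ᶠ i
  ... | yes _ = refl
  ... | no ¬p = ⊥-elim (¬p refl)

==-intro : ∀ {n} {i j : Fin n} → i ≡ j → i == j ≡ true
==-intro refl = ==-refl _

FinSet : ℕ → Set
FinSet n = Fin n → Bool

opaque

  some : ∀ {n} → FinSet n → Bool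
  some {zero}  f = false
  some {suc n} f = f zero ∨ some (f ∘ suc)

  some-intro : ∀ {n} (f : FinSet n) i → f i ≡ true → some f ≡ true
  some-intro f zero    p = ∨-introˡ p
  some-intro f (suc i) p = ∨-introʳ {f zero} (some-intro (f ∘ suc) i p)

  some-elim : ∀ {n} (f : FinSet n) → some f ≡ true → ∃ λ i → f i ≡ true
  some-elim {suc n} f p with ∨-elim {f zero} p
  ... | inj₁ q = zero , q
  ... | inj₂ q with some-elim (f ∘ suc) q
  ...   | i , r = suc i , r

weigh : Bool → ℕ → ℕ
weigh false k = 0
weigh true  k = k

weigh-mono : ∀ {a b k l} → (a ≡ true → b ≡ true × k ≤ l) → weigh a k ≤ weigh b l
weigh-mono {false}     h = z≤n
weigh-mono {true}  {b} h with b | h refl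
... | true | _ , le = le

weigh≤ : ∀ b k → weigh b k ≤ k
weigh≤ false k = z≤n
weigh≤ true  k = ≤-refl

opaque
  unfolding sum

  weight : ∀ {n} → (Fin n → ℕ) → FinSet n → ℕ
  weight d X = sum λ i → weigh (X i) (d i)

  weight-sum : ∀ {n} (d : Fin n → ℕ) (X : FinSet n) → weight d X ≡ sum λ i → weigh (X i) (d i)
  weight-sum d X = refl

#_ : ∀ {n} → FinSet n → ℕ
# X = weight (λ _ → 1) X

_⊆_ : ∀ {n} → FinSet n → FinSet n → Set
X ⊆ Y = ∀ i → X i ≡ true → Y i ≡ true

_∪_ _∩_ _∖_ : ∀ {n} → FinSet n → FinSet n → FinSet n
(X ∪ Y) i = X i ∨ Y i
(X ∩ Y) i = X i ∧ Y i
(X ∖ Y) i = X i ∧ not (Y i)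

∅ : ∀ {n} → FinSet n
∅ _ = false

full : ∀ {n} → FinSet n
full _ = true

∁ : ∀ {n} → FinSet n → FinSet n
∁ X i = not (X i)

infixl 6 _◂_
_◂_ : ∀ {n} → FinSet n → Fin n → FinSet n
(X ◂ x) i = X i ∨ (i == x)

weight-mono : ∀ {n} {d d' : Fin n → ℕ} {X Y : FinSet n} → X ⊆ Y → (∀ i → X i ≡ true → d i ≤ d' i) →
  weight d X ≤ weight d' Y
weight-mono {d = d} {d'} {X} {Y} s h = subst₂ _≤_ (sym (weight-sum d X)) (sym (weight-sum d' Y))
  (sum-mono λ i → weigh-mono λ p → s i p , h i p)

#-mono : ∀ {n} {X Y : FinSet n} → X ⊆ Y → # X ≤ # Y
#-mono s = weight-mono s λ _ _ → ≤-refl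

weight-cong : ∀ {n} (d : Fin n → ℕ) {X Y : FinSet n} → (∀ i → X i ≡ Y i) → weight d X ≡ weight d Y
weight-cong d {X} {Y} h = trans (weight-sum d X)
  (trans (sum-cong λ i → cong (λ b → weigh b (d i)) (h i)) (sym (weight-sum d Y)))

weight-∅ : ∀ {n} (d : Fin n → ℕ) {X : FinSet n} → (∀ i → X i ≡ true → ⊥) → weight d X ≡ 0
weight-∅ d {X} h = trans (weight-sum d X) (sum-zero λ i → cong (λ b → weigh b (d i)) (≡false (h i)))

weight≤* : ∀ {n} {d : Fin n → ℕ} M (X : FinSet n) → (∀ i → d i ≤ M) → weight d X ≤ M * # X
weight≤* {d = d} M X h = subst₂ _≤_ (sym (weight-sum d X))
  (trans (sum-* M (λ i → weigh (X i) 1)) (cong (M *_) (sym (weight-sum (λ _ → 1) X)))) (sum-mono le)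
  where
  le : ∀ i → weigh (X i) (d i) ≤ M * weigh (X i) 1
  le i with X i
  ... | true  = subst (d i ≤_) (sym (*-identityʳ M)) (h i)
  ... | false = z≤n

*≤weight : ∀ {n} {d : Fin n → ℕ} M (X : FinSet n) → (∀ i → X i ≡ true → M ≤ d i) → M * # X ≤ weight d X
*≤weight {d = d} M X h = subst₂ _≤_
  (trans (sum-* M (λ i → weigh (X i) 1)) (cong (M *_) (sym (weight-sum (λ _ → 1) X))))
  (sym (weight-sum d X)) (sum-mono le)
  where
  le : ∀ i → M * weigh (X i) 1 ≤ weigh (X i) (d i)
  le i with X i | h i
  ... | true  | h′ = subst (_≤ d i) (sym (*-identityʳ M)) (h′ refl)
  ... | false | _  = ≤-reflexive (*-zeroʳ M)

weigh-modular : ∀ a b k → weigh (a ∨ b) k + weigh (a ∧ b) k ≡ weigh a k + weigh b k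
weigh-modular false b     k = +-identityʳ _
weigh-modular true  b     k = refl

weight-+ : ∀ {n} (d : Fin n → ℕ) (X Y : FinSet n) →
  weight d X + weight d Y ≡ sum λ i → weigh (X i) (d i) + weigh (Y i) (d i)
weight-+ d X Y = trans (cong₂ _+_ (weight-sum d X) (weight-sum d Y))
  (sym (sum-+ (λ i → weigh (X i) (d i)) (λ i → weigh (Y i) (d i))))

weight-modular : ∀ {n} (d : Fin n → ℕ) (X Y : FinSet n) →
  weight d (X ∪ Y) + weight d (X ∩ Y) ≡ weight d X + weight d Y
weight-modular d X Y = trans (weight-+ d (X ∪ Y) (X ∩ Y))
  (trans (sum-cong λ i → weigh-modular (X i) (Y i) (d i)) (sym (weight-+ d X Y)))

weight-∪ : ∀ {n} (d : Fin n → ℕ) (X Y : FinSet n) → weight d (X ∪ Y) ≤ weight d X + weight d Y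
weight-∪ d X Y = m+n≤o⇒m≤o (weight d (X ∪ Y)) (≤-reflexive (weight-modular d X Y))

weight-disjoint : ∀ {n} (d : Fin n → ℕ) (X Y : FinSet n) → (∀ i → X i ≡ true → Y i ≡ true → ⊥) →
  weight d (X ∪ Y) ≡ weight d X + weight d Y
weight-disjoint d X Y dis = trans (sym (+-identityʳ _))
  (trans (cong (weight d (X ∪ Y) +_) (sym (weight-∅ d λ i p → let (q , r) = ∧-elim {X i} p in dis i q r)))
         (weight-modular d X Y))

#-cover : ∀ {n} {X Y Z : FinSet n} → (∀ i → X i ≡ true → Y i ≡ true ⊎ Z i ≡ true) → # X ≤ # Y + # Z
#-cover {Y = Y} {Z} h = ≤-trans (#-mono λ i p → case (h i p)) (weight-∪ _ Y Z)
  where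
  case : ∀ {a b} → a ≡ true ⊎ b ≡ true → a ∨ b ≡ true
  case         (inj₁ p) = ∨-introˡ p
  case {a} {b} (inj₂ p) = ∨-introʳ {a} {b} p

opaque
  unfolding sum weight _==_

  weight-single : ∀ {n} (d : Fin n → ℕ) x → weight d (_== x) ≡ d x
  weight-single {suc n} d zero = trans (cong (d zero +_) (sum-zero {n} λ i → refl)) (+-identityʳ _)
  weight-single {suc n} d (suc x) = trans
    (sum-cong {n} λ i → cong (λ b → weigh b (d (suc i))) (eq i)) (weight-single (d ∘ suc) x)
    where
    eq : ∀ i → suc i == suc x ≡ (i == x)
    eq i with i ≟ᶠ x
    ... | yes _ = refl
    ... | no  _ = refl

  #-full : ∀ {n} → # (full {n}) ≡ n
  #-full {zero}  = refl
  #-full {suc n} = cong suc (#-full {n})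

  ∣tabulate∣ : ∀ {n} (X : FinSet n) → ∣ tabulate X ∣ ≡ # X
  ∣tabulate∣ {zero}  X = refl
  ∣tabulate∣ {suc n} X with X zero
  ... | true  = cong suc (∣tabulate∣ (X ∘ suc))
  ... | false = ∣tabulate∣ (X ∘ suc)

  subset-of-size : ∀ {n} a (X : FinSet n) → a ≤ # X → ∃ λ Y → Y ⊆ X × # Y ≡ a
  subset-of-size {n}     zero    X le = ∅ , (λ _ ()) , weight-∅ {n} (λ _ → 1) λ _ ()
  subset-of-size {suc n} (suc a) X le with X zero in eq
  ... | true with subset-of-size a (X ∘ suc) (≤-pred le)
  ...   | Y , s , c = (λ { zero → true ; (suc i) → Y i }) , (λ { zero _ → eq ; (suc i) p → s i p }) , cong suc c
  subset-of-size {suc n} (suc a) X le | false with subset-of-size (suc a) (X ∘ suc) le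
  ...   | Y , s , c = (λ { zero → false ; (suc i) → Y i }) , (λ { (suc i) p → s i p }) , c

weight-◂ : ∀ {n} (d : Fin n → ℕ) {X : FinSet n} {x} → X x ≡ false → weight d (X ◂ x) ≡ weight d X + d x
weight-◂ d {X} {x} p = trans
  (weight-disjoint d X (_== x) λ i q r → true≢false q (subst (λ j → X j ≡ false) (sym (==-elim r)) p))
  (cong (weight d X +_) (weight-single d x))

#-single : ∀ {n} (x : Fin n) → # (_== x) ≡ 1
#-single x = weight-single (λ _ → 1) x

#-◂ : ∀ {n} {X : FinSet n} {x} → X x ≡ false → # (X ◂ x) ≡ suc (# X)
#-◂ p = trans (weight-◂ _ p) (+-comm _ 1)

#-◂≤ : ∀ {n} (X : FinSet n) x → # (X ◂ x) ≤ suc (# X)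
#-◂≤ X x = ≤-trans (weight-∪ _ X (_== x))
  (≤-reflexive (trans (cong (# X +_) (#-single x)) (+-comm _ 1)))

◂-elim : ∀ {n} {X : FinSet n} {x i} → (X ◂ x) i ≡ true → X i ≡ true ⊎ i ≡ x
◂-elim {X = X} {i = i} p with ∨-elim {X i} p
... | inj₁ q = inj₁ q
... | inj₂ q = inj₂ (==-elim q)

◂-old : ∀ {n} {X : FinSet n} {x i} → X i ≡ true → (X ◂ x) i ≡ true
◂-old p = ∨-introˡ p

◂-new : ∀ {n} {X : FinSet n} {x} → (X ◂ x) x ≡ true
◂-new {X = X} {x} = ∨-introʳ {X x} (==-refl x)

◂-⊆ : ∀ {n} {X Y : FinSet n} {x} → X ⊆ Y → Y x ≡ true → (X ◂ x) ⊆ Y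
◂-⊆ {X = X} s y i p with ◂-elim {X = X} p
... | inj₁ q    = s i q
... | inj₂ refl = y

#≤n : ∀ {n} (X : FinSet n) → # X ≤ n
#≤n X = subst (# X ≤_) #-full (#-mono λ _ _ → refl)

#-∁ : ∀ {n} (X : FinSet n) → # X + # (∁ X) ≡ n
#-∁ X = trans (sym (weight-disjoint _ X (∁ X) λ i p q → true≢false p (not-elim q)))
  (trans (weight-cong _ λ i → excluded-middle (X i)) #-full)
  where
  excluded-middle : ∀ a → a ∨ not a ≡ true
  excluded-middle true  = refl
  excluded-middle false = refl

none : ∀ {n} {X : FinSet n} → some X ≡ false → ∀ i → X i ≡ true → ⊥
none {X = X} q i r = true≢false (some-intro X i r) q

missing-or-⊆ : ∀ {n} (X Y : FinSet n) → (∃ λ i → X i ≡ true × Y i ≡ false) ⊎ X ⊆ Y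
missing-or-⊆ X Y with bool (some (X ∖ Y))
... | inj₁ p = let (i , q) = some-elim _ p ; (a , b) = ∧-elim {X i} q in inj₁ (i , a , not-elim b)
... | inj₂ p = inj₂ λ i q → decide i q (bool (Y i))
  where
  decide : ∀ i → X i ≡ true → Y i ≡ true ⊎ Y i ≡ false → Y i ≡ true
  decide i q (inj₁ r) = r
  decide i q (inj₂ r) = ⊥-elim (none p i (∧-intro q (not-intro r)))

#-pos : ∀ {n} (X : FinSet n) → 1 ≤ # X → ∃ λ i → X i ≡ true
#-pos X p with bool (some X)
... | inj₁ q = some-elim X q
... | inj₂ q = ⊥-elim (<⇒≱ p (≤-reflexive (weight-∅ _ (none q))))

#-mem : ∀ {n} (X : FinSet n) i → X i ≡ true → 1 ≤ # X
#-mem X i p = ≤-trans (≤-reflexive (sym (#-single i)))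
  (#-mono {X = _== i} λ j q → subst (λ k → X k ≡ true) (sym (==-elim q)) p)

#-unique : ∀ {n} (X : FinSet n) → (∀ i j → X i ≡ true → X j ≡ true → i ≡ j) → # X ≤ 1
#-unique X h with bool (some X)
... | inj₁ q = let (x , p) = some-elim X q in
  ≤-trans (#-mono {Y = _== x} λ i r → ==-intro (h i x r p)) (≤-reflexive (#-single x))
... | inj₂ q = ≤-trans (≤-reflexive (weight-∅ _ (none q))) z≤n

unique-of-#1 : ∀ {n} (X : FinSet n) → # X ≡ 1 → ∀ i j → X i ≡ true → X j ≡ true → i ≡ j
unique-of-#1 X c i j p q with i ≟ᶠ j
... | yes e = e
... | no ne = ⊥-elim (<⇒≱ (≤-refl {2}) (≤-trans two (≤-reflexive c)))
  where
  pair⊆ : ((_== i) ◂ j) ⊆ X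
  pair⊆ k r with ◂-elim {X = _== i} r
  ... | inj₁ e = subst (λ z → X z ≡ true) (sym (==-elim e)) p
  ... | inj₂ e = subst (λ z → X z ≡ true) (sym e) q
  two : 2 ≤ # X
  two = ≤-trans
    (≤-reflexive (sym (trans (#-◂ {X = _== i} {j} (≡false λ r → ne (sym (==-elim r)))) (cong suc (#-single i)))))
    (#-mono pair⊆)

double-count : ∀ {m n} (R : Fin m → Fin n → Bool) → sum (λ i → # (R i)) ≡ sum (λ j → # (λ i → R i j))
double-count R = trans (sum-cong λ i → weight-sum (λ _ → 1) (R i))
  (trans (sum-swap λ i j → weigh (R i j) 1) (sum-cong λ j → sym (weight-sum (λ _ → 1) λ i → R i j)))

#≤sum : ∀ {n} (X : FinSet n) {f : Fin n → ℕ} → (∀ i → X i ≡ true → 1 ≤ f i) → # X ≤ sum f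
#≤sum X {f} h = subst (_≤ sum f) (sym (weight-sum _ X)) (sum-mono le)
  where
  le : ∀ i → weigh (X i) 1 ≤ f i
  le i with X i | h i
  ... | true  | h′ = h′ refl
  ... | false | _  = z≤n

sum≤# : ∀ {n} (X : FinSet n) {f : Fin n → ℕ} → (∀ i → f i ≤ weigh (X i) 1) → sum f ≤ # X
sum≤# X {f} h = subst (sum f ≤_) (sym (weight-sum _ X)) (sum-mono h)

#-image≤ : ∀ {m n} (A : FinSet m) (B : FinSet n) (φ : Fin m → Fin n) →
  (∀ y → B y ≡ true → ∃ λ t → A t ≡ true × φ t ≡ y) → # B ≤ # A
#-image≤ A B φ h = begin
  # B                                    ≤⟨ #≤sum B pre ⟩
  sum (λ y → # (λ t → A t ∧ (φ t == y))) ≡⟨ double-count (λ y t → A t ∧ (φ t == y)) ⟩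
  sum (λ t → # (λ y → A t ∧ (φ t == y))) ≤⟨ sum≤# A post ⟩
  # A                                    ∎
  where
  open ≤-Reasoning
  pre : ∀ y → B y ≡ true → 1 ≤ # (λ t → A t ∧ (φ t == y))
  pre y p = let (t , a , e) = h y p in #-mem _ t (∧-intro a (==-intro e))
  post : ∀ t → # (λ y → A t ∧ (φ t == y)) ≤ weigh (A t) 1
  post t with A t
  ... | false = ≤-reflexive (weight-∅ _ λ _ ())
  ... | true  = #-unique _ λ i j p q → trans (sym (==-elim p)) (==-elim q)

#-injective≤ : ∀ {m n} (A : FinSet m) (B : FinSet n) (φ : Fin m → Fin n) →
  (∀ t → A t ≡ true → B (φ t) ≡ true) → (∀ s t → A s ≡ true → A t ≡ true → φ s ≡ φ t → s ≡ t) → # A ≤ # B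
#-injective≤ A B φ into inj = begin
  # A                                    ≤⟨ #≤sum A (λ t a → #-mem _ (φ t) (∧-intro a (==-refl (φ t)))) ⟩
  sum (λ t → # (λ y → A t ∧ (φ t == y))) ≡⟨ double-count (λ t y → A t ∧ (φ t == y)) ⟩
  sum (λ y → # (λ t → A t ∧ (φ t == y))) ≤⟨ sum≤# B post ⟩
  # B                                    ∎
  where
  open ≤-Reasoning
  post : ∀ y → # (λ t → A t ∧ (φ t == y)) ≤ weigh (B y) 1
  post y with bool (B y)
  ... | inj₁ b rewrite b = #-unique _ λ s t p q →
    let (as , es) = ∧-elim {A s} p; (at , et) = ∧-elim {A t} q in
    inj s t as at (trans (==-elim es) (sym (==-elim et)))
  ... | inj₂ b = ≤-trans (≤-reflexive (weight-∅ _ λ t p → let (a , e) = ∧-elim {A t} p in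
    true≢false (subst (λ z → B z ≡ true) (==-elim e) (into t a)) b)) z≤n

∀-or-counterexample : ∀ {n} {P : FinSet n → Set} → (∀ X → Dec (P X)) →
  (∀ X Y → (∀ i → X i ≡ Y i) → P X → P Y) → (∀ X → P X) ⊎ ∃ λ X → ¬ P X
∀-or-counterexample P? resp with anySubset? (λ v → ¬? (P? (Vec.lookup v)))
... | yes (v , ¬p) = inj₂ (Vec.lookup v , ¬p)
... | no ¬ex = inj₁ λ X → resp (Vec.lookup (tabulate X)) X (lookup∘tabulate X)
      (decidable-stable (P? _) λ ¬p → ¬ex (tabulate X , ¬p))

opaque

  Γ : ∀ {n} → (Fin n → Fin n → Bool) → FinSet n → FinSet n
  Γ R X y = some λ x → X x ∧ R x y

  Γ-intro : ∀ {n} {R : Fin n → Fin n → Bool} {X : FinSet n} {x y} → X x ≡ true → R x y ≡ true → Γ R X y ≡ true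
  Γ-intro p q = some-intro _ _ (∧-intro p q)

  Γ-elim : ∀ {n} {R : Fin n → Fin n → Bool} {X : FinSet n} {y} → Γ R X y ≡ true → ∃ λ x → X x ≡ true × R x y ≡ true
  Γ-elim {X = X} p with some-elim _ p
  ... | x , q = x , ∧-elim {X x} q

Γ-mono : ∀ {n} {R R' : Fin n → Fin n → Bool} {X X' : FinSet n} → X ⊆ X' →
  (∀ x y → X x ≡ true → R x y ≡ true → R' x y ≡ true) → Γ R X ⊆ Γ R' X'
Γ-mono {R = R} {R'} {X} {X'} s h y p with Γ-elim {R = R} {X} p
... | x , a , b = Γ-intro {R = R'} {X'} (s x a) (h x y a b)

-- Taylor polynomials of the exponential, and Bernoulli's inequality

suc-pow≤ : ∀ y j → suc y ^ suc j ≤ y ^ suc j + suc j * suc y ^ j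
suc-pow≤ y zero = ≤-reflexive (eq y)
  where
  eq : ∀ y → suc y * 1 ≡ y * 1 + 1 * 1
  eq = solve-∀
suc-pow≤ y (suc j) = begin
  suc y * p                                  ≤⟨ *-monoʳ-≤ (suc y) ≤-refl ⟩
  p + y * p                                  ≤⟨ +-monoʳ-≤ p (*-monoʳ-≤ y (suc-pow≤ y j)) ⟩
  p + y * (q + suc j * r)                    ≤⟨ m≤m+n _ (suc j * r) ⟩
  p + y * (q + suc j * r) + suc j * r        ≡⟨ eq y j p q r ⟩
  y * q + (p + suc j * (suc y * r))          ∎
  where
  open ≤-Reasoning
  p = suc y ^ suc j
  q = y ^ suc j
  r = suc y ^ j
  eq : ∀ y j p q r → p + y * (q + suc j * r) + suc j * r ≡ y * q + (p + suc j * (suc y * r))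
  eq = solve-∀

-- 2^K K! times the K-th Taylor polynomial of e^(y/2). It at most doubles when y grows by 1, whence e^x ≤ 4^x.
halfExp : ℕ → ℕ → ℕ
halfExp y zero    = 1
halfExp y (suc K) = 2 * suc K * halfExp y K + y ^ suc K

halfExp-suc : ∀ y K → halfExp (suc y) (suc K) ≤ halfExp y (suc K) + suc K * halfExp (suc y) K
halfExp-suc y zero = ≤-reflexive (eq y)
  where
  eq : ∀ y → 2 * 1 * 1 + suc y * 1 ≡ 2 * 1 * 1 + y * 1 + 1 * 1
  eq = solve-∀
halfExp-suc y (suc K) = begin
  2 * suc (suc K) * e + suc y ^ suc (suc K)
    ≤⟨ +-mono-≤ (*-monoʳ-≤ (2 * suc (suc K)) (halfExp-suc y K)) (suc-pow≤ y (suc K)) ⟩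
  2 * suc (suc K) * (f + suc K * g) + (p + suc (suc K) * q)
    ≡⟨ eq K f g p q ⟩
  2 * suc (suc K) * f + p + suc (suc K) * (2 * suc K * g + q) ∎
  where
  open ≤-Reasoning
  e = halfExp (suc y) (suc K)
  f = halfExp y (suc K)
  g = halfExp (suc y) K
  p = y ^ suc (suc K)
  q = suc y ^ suc K
  eq : ∀ K f g p q → 2 * suc (suc K) * (f + suc K * g) + (p + suc (suc K) * q)
     ≡ 2 * suc (suc K) * f + p + suc (suc K) * (2 * suc K * g + q)
  eq = solve-∀

halfExp-double : ∀ y K → halfExp (suc y) K ≤ 2 * halfExp y K
halfExp-double y zero    = s≤s z≤n
halfExp-double y (suc K) = linear (suc y ^ suc K) (*-monoʳ-≤ 2 (halfExp-suc y K))
  (eq K (halfExp (suc y) K) (halfExp y (suc K)) (suc y ^ suc K))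
  where
  eq : ∀ K g f p → 2 * f + 2 * (2 * suc K * g + p) ≡ (2 * suc K * g + p) + 2 * (f + suc K * g) + p
  eq = solve-∀

halfExp-zero : ∀ K → halfExp 0 K ≡ 2 ^ K * K !
halfExp-zero zero    = refl
halfExp-zero (suc K) = trans (cong (λ z → 2 * suc K * z + 0) (halfExp-zero K)) (eq K (2 ^ K) (K !))
  where
  eq : ∀ K a b → 2 * suc K * (a * b) + 0 ≡ 2 * a * (suc K * b)
  eq = solve-∀

halfExp≤ : ∀ y K → halfExp y K ≤ 2 ^ y * (2 ^ K * K !)
halfExp≤ zero    K = ≤-reflexive (trans (halfExp-zero K) (sym (+-identityʳ _)))
halfExp≤ (suc y) K = begin
  halfExp (suc y) K         ≤⟨ halfExp-double y K ⟩
  2 * halfExp y K           ≤⟨ *-monoʳ-≤ 2 (halfExp≤ y K) ⟩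
  2 * (2 ^ y * (2 ^ K * K !)) ≡⟨ *-assoc 2 (2 ^ y) _ ⟨
  2 * 2 ^ y * (2 ^ K * K !) ∎
  where open ≤-Reasoning

*-^ : ∀ a b k → (a * b) ^ k ≡ a ^ k * b ^ k
*-^ a b zero    = refl
*-^ a b (suc k) = trans (cong (a * b *_) (*-^ a b k)) (eq a b (a ^ k) (b ^ k))
  where
  eq : ∀ a b c d → a * b * (c * d) ≡ a * c * (b * d)
  eq = solve-∀

suc-P′ : ∀ n k → suc n P′ suc k ≡ suc n * (n P′ k)
suc-P′ n zero    = refl
suc-P′ n (suc k) = trans (cong ((n ∸ k) *_) (suc-P′ n k)) (eq (n ∸ k) (suc n) (n P′ k))
  where
  eq : ∀ a b c → a * (b * c) ≡ b * (a * c)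
  eq = solve-∀

≤ᵇ-suc : ∀ k n → (suc k ≤ᵇ suc n) ≡ (k ≤ᵇ n)
≤ᵇ-suc zero    n = refl
≤ᵇ-suc (suc k) n = refl

suc-P : ∀ n k → suc n P suc k ≡ suc n * (n P k)
suc-P n k rewrite ≤ᵇ-suc k n with k ≤ᵇ n
... | true  = suc-P′ n k
... | false = sym (*-zeroʳ (suc n))

sum-upTo-suc : ∀ (f : ℕ → ℕ) J → List.sum (map f (upTo (suc J))) ≡ List.sum (map f (upTo J)) + f J
sum-upTo-suc f J = trans (cong (List.sum ∘ map f) (sym (upTo-∷ʳ J)))
  (trans (cong List.sum (map-++ f (upTo J) (J ∷ [])))
  (trans (List.sum-++ (map f (upTo J)) _) (cong (List.sum (map f (upTo J)) +_) (+-identityʳ (f J)))))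

expScaled-suc : ∀ x K → expScaled x (suc K) ≡ suc K * expScaled x K + x ^ suc K
expScaled-suc x K = trans (sum-upTo-suc (λ j → x ^ j * (suc K P (suc K ∸ j))) (suc K))
  (cong₂ _+_ (prefix (suc K) ≤-refl)
    (trans (cong (λ z → x ^ suc K * (suc K P z)) (n∸n≡0 K)) (*-identityʳ _)))
  where
  eq : ∀ a b s p → a * s + p * (a * b) ≡ a * (s + p * b)
  eq = solve-∀
  prefix : ∀ J → J ≤ suc K → List.sum (map (λ j → x ^ j * (suc K P (suc K ∸ j))) (upTo J))
         ≡ suc K * List.sum (map (λ j → x ^ j * (K P (K ∸ j))) (upTo J))
  prefix zero    _  = sym (*-zeroʳ (suc K))
  prefix (suc J) le = begin
    List.sum (map f (upTo (suc J)))  ≡⟨ sum-upTo-suc f J ⟩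
    List.sum (map f (upTo J)) + x ^ J * (suc K P (suc K ∸ J))
      ≡⟨ cong₂ (λ a b → a + x ^ J * b) (prefix J (≤-trans (n≤1+n J) le))
           (trans (cong (suc K P_) (+-∸-assoc 1 (≤-pred le))) (suc-P K (K ∸ J))) ⟩
    suc K * List.sum (map g (upTo J)) + x ^ J * (suc K * (K P (K ∸ J)))
      ≡⟨ eq (suc K) (K P (K ∸ J)) (List.sum (map g (upTo J))) (x ^ J) ⟩
    suc K * (List.sum (map g (upTo J)) + x ^ J * (K P (K ∸ J)))
      ≡⟨ cong (suc K *_) (sum-upTo-suc g J) ⟨
    suc K * List.sum (map g (upTo (suc J))) ∎
    where
    open ≡-Reasoning
    f g : ℕ → ℕ
    f j = x ^ j * (suc K P (suc K ∸ j))
    g j = x ^ j * (K P (K ∸ j))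

halfExp≡expScaled : ∀ x K → halfExp (2 * x) K ≡ 2 ^ K * expScaled x K
halfExp≡expScaled x zero    = refl
halfExp≡expScaled x (suc K) = begin
  2 * suc K * halfExp (2 * x) K + (2 * x) ^ suc K
    ≡⟨ cong₂ (λ a b → 2 * suc K * a + b) (halfExp≡expScaled x K) (*-^ 2 x (suc K)) ⟩
  2 * suc K * (2 ^ K * expScaled x K) + 2 * 2 ^ K * (x ^ suc K)
    ≡⟨ eq (suc K) (2 ^ K) (expScaled x K) (x ^ suc K) ⟩
  2 * 2 ^ K * (suc K * expScaled x K + x ^ suc K)
    ≡⟨ cong (2 * 2 ^ K *_) (expScaled-suc x K) ⟨
  2 * 2 ^ K * expScaled x (suc K) ∎
  where
  open ≡-Reasoning
  eq : ∀ k a e p → 2 * k * (a * e) + 2 * a * p ≡ 2 * a * (k * e + p)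
  eq = solve-∀

expScaled≤ : ∀ x K → expScaled x K ≤ 4 ^ x * K !
expScaled≤ x K = *-cancelˡ-≤ (2 ^ K) {{m^n≢0 2 K}} (begin
  2 ^ K * expScaled x K           ≡⟨ halfExp≡expScaled x K ⟨
  halfExp (2 * x) K               ≤⟨ halfExp≤ (2 * x) K ⟩
  2 ^ (2 * x) * (2 ^ K * K !)     ≡⟨ cong (_* (2 ^ K * K !)) (^-*-assoc 2 2 x) ⟨
  4 ^ x * (2 ^ K * K !)           ≡⟨ eq (4 ^ x) (2 ^ K) (K !) ⟩
  2 ^ K * (4 ^ x * K !)           ∎)
  where
  open ≤-Reasoning
  eq : ∀ a b c → a * (b * c) ≡ b * (a * c)
  eq = solve-∀

LogCond⇒ : ∀ {m₁ m₂ n} → LogCond m₁ m₂ n → n ^ (6 * m₁) < 4 ^ m₂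
LogCond⇒ {m₁} {m₂} {n} (K , lt) = *-cancelʳ-< (K !) _ _ (<-≤-trans lt (expScaled≤ m₂ K))

LogCond⇒6m₁<m₂ : ∀ {m₁ m₂ n} → 4 ≤ n → LogCond m₁ m₂ n → 6 * m₁ < m₂
LogCond⇒6m₁<m₂ {m₁} {m₂} {n} 4≤n lc with 6 * m₁ <? m₂
... | yes lt = lt
... | no ¬lt = ⊥-elim (<⇒≱ (LogCond⇒ {m₁} {m₂} lc)
  (≤-trans (^-monoʳ-≤ 4 (≮⇒≥ ¬lt)) (^-monoˡ-≤ (6 * m₁) 4≤n)))


-- Bernoulli's inequality (N/(N+1))^k ≥ 1 − k/(N+1), with the negative term moved to the left.
reverse-bernoulli : ∀ N k → suc N ^ suc k ≤ N ^ k * suc N + k * suc N ^ k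
reverse-bernoulli N zero    = ≤-reflexive (eq N)
  where
  eq : ∀ N → suc N * 1 ≡ 1 * suc N + 0 * 1
  eq = solve-∀
reverse-bernoulli N (suc k) = begin
  suc N * (suc N * p)                       ≡⟨ eq₁ N p ⟩
  N * (suc N * p) + suc N * p               ≤⟨ +-monoˡ-≤ (suc N * p) (*-monoʳ-≤ N (reverse-bernoulli N k)) ⟩
  N * (q * suc N + k * p) + suc N * p       ≤⟨ m≤m+n _ (k * p) ⟩
  N * (q * suc N + k * p) + suc N * p + k * p ≡⟨ eq₂ N k p q ⟩
  N * q * suc N + suc k * (suc N * p)       ∎
  where
  open ≤-Reasoning
  p = suc N ^ k
  q = N ^ k
  eq₁ : ∀ N p → suc N * (suc N * p) ≡ N * (suc N * p) + suc N * p
  eq₁ = solve-∀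
  eq₂ : ∀ N k p q → N * (q * suc N + k * p) + suc N * p + k * p ≡ N * q * suc N + suc k * (suc N * p)
  eq₂ = solve-∀

growth : ∀ D → 3 * suc (24 * D) ^ (6 * D) ≤ 4 * (24 * D) ^ (6 * D)
growth D = *-cancelʳ-≤ _ _ (suc N) (linear (p * 1) (*-monoʳ-≤ 4 (reverse-bernoulli N k)) (eq D p q))
  where
  N = 24 * D
  k = 6 * D
  p = suc N ^ k
  q = N ^ k
  eq : ∀ D p q → 4 * q * suc (24 * D) + 4 * (suc (24 * D) * p)
     ≡ 3 * p * suc (24 * D) + 4 * (q * suc (24 * D) + 6 * D * p) + p * 1
  eq = solve-∀

-- A set W meeting every set of non-neighbours in few vertices

weight-sum-+ : ∀ {n} (f g : Fin n → ℕ) (X : FinSet n) → weight (λ i → f i + g i) X ≡ weight f X + weight g X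
weight-sum-+ f g X = trans (weight-sum (λ i → f i + g i) X) (trans (sum-cong λ i → lem (X i) (f i) (g i))
  (trans (sum-+ (λ i → weigh (X i) (f i)) (λ i → weigh (X i) (g i)))
         (sym (cong₂ _+_ (weight-sum f X) (weight-sum g X)))))
  where
  lem : ∀ b x y → weigh b (x + y) ≡ weigh b x + weigh b y
  lem true  x y = refl
  lem false x y = refl

weight-* : ∀ {n} k (f : Fin n → ℕ) (X : FinSet n) → weight (λ i → k * f i) X ≡ k * weight f X
weight-* k f X = trans (weight-sum (λ i → k * f i) X) (trans (sum-cong λ i → lem (X i) (f i))
  (trans (sum-* k λ i → weigh (X i) (f i)) (cong (k *_) (sym (weight-sum f X)))))
  where
  lem : ∀ b x → weigh b (k * x) ≡ k * weigh b x
  lem true  x = refl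
  lem false x = sym (*-zeroʳ k)

below-average : ∀ {n} (f : Fin n → ℕ) (X : FinSet n) {K M} → 1 ≤ # X → K * weight f X ≤ M * # X →
  ∃ λ v → X v ≡ true × K * f v ≤ M
below-average f X {K} {M} pos avg with bool (some λ v → X v ∧ (K * f v ≤ᵇ M))
... | inj₁ p = let (v , q) = some-elim _ p; (a , b) = ∧-elim {X v} q in v , a , ≤ᵇ⇒≤ _ _ (subst IsTrue (sym b) _)
... | inj₂ p = ⊥-elim (<⇒≱ pos (+-cancelʳ-≤ (M * # X) _ _ (begin
  suc M * # X                  ≤⟨ *≤weight (suc M) X above ⟩
  weight (λ v → K * f v) X     ≡⟨ weight-* K f X ⟩
  K * weight f X               ≤⟨ avg ⟩
  M * # X                      ∎)))
  where
  open ≤-Reasoning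
  above : ∀ v → X v ≡ true → suc M ≤ K * f v
  above v x = ≰⇒> λ le → none p v (∧-intro x (T⇒≡ (≤⇒≤ᵇ le)))
    where
    T⇒≡ : ∀ {b} → IsTrue b → b ≡ true
    T⇒≡ {true} _ = refl

module _ {n : ℕ} where

  potential : FinSet n → List (FinSet n) → ℕ
  potential W []       = 0
  potential W (Z ∷ Zs) = 2 ^ # (W ∩ Z) + potential W Zs

  potential-∅ : ∀ Zs → potential ∅ Zs ≡ length Zs
  potential-∅ []       = refl
  potential-∅ (Z ∷ Zs) = cong₂ _+_ (cong (2 ^_) (weight-∅ _ λ _ ())) (potential-∅ Zs)

  potential<⇒ : ∀ W m Zs → potential W Zs < 2 ^ m → All (λ Z → # (W ∩ Z) < m) Zs
  potential<⇒ W m []       _  = []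
  potential<⇒ W m (Z ∷ Zs) lt =
    ≰⇒> (λ le → <⇒≱ lt (≤-trans (^-monoʳ-≤ 2 le) (m≤m+n _ _))) ∷
    potential<⇒ W m Zs (≤-<-trans (m≤n+m _ _) lt)

  average-term : ∀ W (Z : FinSet n) N → N * # Z ≤ # (∁ W) →
    N * weight (λ v → 2 ^ # ((W ◂ v) ∩ Z)) (∁ W) ≤ suc N * 2 ^ # (W ∩ Z) * # (∁ W)
  average-term W Z N small = begin
    N * weight (λ v → 2 ^ # ((W ◂ v) ∩ Z)) (∁ W)
      ≤⟨ *-monoʳ-≤ N (weight-mono {Y = ∁ W} (λ _ p → p) λ v _ → bound v) ⟩
    N * weight (λ v → c + weigh (Z v) c) (∁ W)
      ≡⟨ cong (N *_) (weight-sum-+ (λ _ → c) (λ v → weigh (Z v) c) (∁ W)) ⟩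
    N * (weight (λ _ → c) (∁ W) + weight (λ v → weigh (Z v) c) (∁ W))
      ≤⟨ *-monoʳ-≤ N (+-mono-≤ (weight≤* c (∁ W) λ _ → ≤-refl) (begin
           weight (λ v → weigh (Z v) c) (∁ W)
             ≤⟨ weight-mono {d = λ v → weigh (Z v) c} {Y = full} (λ _ _ → refl) (λ _ _ → ≤-refl) ⟩
           weight (λ v → weigh (Z v) c) full  ≡⟨ weight-sum _ full ⟩
           sum (λ v → weigh (Z v) c)          ≡⟨ weight-sum _ Z ⟨
           weight (λ _ → c) Z                 ≤⟨ weight≤* c Z (λ _ → ≤-refl) ⟩
           c * # Z                            ∎)) ⟩
    N * (c * # (∁ W) + c * # Z)
      ≤⟨ linear 0 (*-monoʳ-≤ c small) (eq N c (# (∁ W)) (# Z)) ⟩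
    suc N * c * # (∁ W) ∎
    where
    open ≤-Reasoning
    c = 2 ^ # (W ∩ Z)
    eq : ∀ N c w z → suc N * c * w + c * (N * z) ≡ N * (c * w + c * z) + c * w + 0
    eq = solve-∀
    cover : ∀ v → # ((W ◂ v) ∩ Z) ≤ # (W ∩ Z) + weigh (Z v) 1
    cover v with bool (Z v)
    ... | inj₁ z rewrite z = ≤-trans (#-cover {Y = W ∩ Z} {_== v} split)
      (≤-reflexive (cong (# (W ∩ Z) +_) (#-single v)))
      where
      split : ∀ i → ((W ◂ v) ∩ Z) i ≡ true → (W ∩ Z) i ≡ true ⊎ i == v ≡ true
      split i p with ∧-elim {(W ◂ v) i} p
      ... | q , r with ◂-elim {X = W} q
      ...   | inj₁ a = inj₁ (∧-intro a r)
      ...   | inj₂ e = inj₂ (==-intro e)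
    ... | inj₂ z rewrite z = ≤-trans (#-mono {Y = W ∩ Z} sub) (m≤m+n _ _)
      where
      sub : ∀ i → ((W ◂ v) ∩ Z) i ≡ true → (W ∩ Z) i ≡ true
      sub i p with ∧-elim {(W ◂ v) i} p
      ... | q , r with ◂-elim {X = W} q
      ...   | inj₁ a = ∧-intro a r
      ...   | inj₂ refl = true≢false r z
    bound : ∀ v → 2 ^ # ((W ◂ v) ∩ Z) ≤ c + weigh (Z v) c
    bound v with Z v | cover v
    ... | true  | le = begin
      2 ^ # ((W ◂ v) ∩ Z)   ≤⟨ ^-monoʳ-≤ 2 le ⟩
      2 ^ (# (W ∩ Z) + 1)   ≡⟨ cong (2 ^_) (+-comm (# (W ∩ Z)) 1) ⟩
      c + (c + 0)           ≡⟨ cong (c +_) (+-identityʳ c) ⟩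
      c + c                 ∎
    ... | false | le = begin
      2 ^ # ((W ◂ v) ∩ Z)   ≤⟨ ^-monoʳ-≤ 2 le ⟩
      2 ^ (# (W ∩ Z) + 0)   ≡⟨ cong (2 ^_) (+-identityʳ (# (W ∩ Z))) ⟩
      c                     ≤⟨ m≤m+n c 0 ⟩
      c + 0                 ∎

  average : ∀ W N Zs → All (λ Z → N * # Z ≤ # (∁ W)) Zs →
    N * weight (λ v → potential (W ◂ v) Zs) (∁ W) ≤ suc N * potential W Zs * # (∁ W)
  average W N [] [] = ≤-trans (≤-reflexive (trans (cong (N *_) zero-weight) (*-zeroʳ N))) z≤n
    where
    zero-weight : weight (λ _ → 0) (∁ W) ≡ 0
    zero-weight = n≤0⇒n≡0 (weight≤* 0 (∁ W) λ _ → ≤-refl)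
  average W N (Z ∷ Zs) (s ∷ ss) = begin
    N * weight (λ v → 2 ^ # ((W ◂ v) ∩ Z) + potential (W ◂ v) Zs) (∁ W)
      ≡⟨ cong (N *_) (weight-sum-+ (λ v → 2 ^ # ((W ◂ v) ∩ Z)) (λ v → potential (W ◂ v) Zs) (∁ W)) ⟩
    N * (weight (λ v → 2 ^ # ((W ◂ v) ∩ Z)) (∁ W) + weight (λ v → potential (W ◂ v) Zs) (∁ W))
      ≡⟨ *-distribˡ-+ N _ _ ⟩
    N * weight (λ v → 2 ^ # ((W ◂ v) ∩ Z)) (∁ W) + N * weight (λ v → potential (W ◂ v) Zs) (∁ W)
      ≤⟨ +-mono-≤ (average-term W Z N s) (average W N Zs ss) ⟩
    suc N * 2 ^ # (W ∩ Z) * # (∁ W) + suc N * potential W Zs * # (∁ W)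
      ≡⟨ eq (suc N) (2 ^ # (W ∩ Z)) (potential W Zs) (# (∁ W)) ⟩
    suc N * (2 ^ # (W ∩ Z) + potential W Zs) * # (∁ W) ∎
    where
    open ≤-Reasoning
    eq : ∀ N c p w → N * c * w + N * p * w ≡ N * (c + p) * w
    eq = solve-∀

  greedy : ∀ N Zs j → (∀ (W : FinSet n) → # W < j → 1 ≤ # (∁ W) × All (λ Z → N * # Z ≤ # (∁ W)) Zs) →
    ∃ λ W → # W ≡ j × N ^ j * potential W Zs ≤ suc N ^ j * length Zs
  greedy N Zs zero    _ = ∅ , weight-∅ _ (λ _ ()) , ≤-reflexive (cong (1 *_) (potential-∅ Zs))
  greedy N Zs (suc j) h = W ◂ v , trans (#-◂ {X = W} (not-elim v∉W)) (cong suc size) , (begin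
    N * N ^ j * potential (W ◂ v) Zs     ≡⟨ eq₁ N (N ^ j) (potential (W ◂ v) Zs) ⟩
    N ^ j * (N * potential (W ◂ v) Zs)   ≤⟨ *-monoʳ-≤ (N ^ j) le ⟩
    N ^ j * (suc N * potential W Zs)     ≡⟨ eq₂ (N ^ j) (suc N) (potential W Zs) ⟩
    suc N * (N ^ j * potential W Zs)     ≤⟨ *-monoʳ-≤ (suc N) pot ⟩
    suc N * (suc N ^ j * length Zs)      ≡⟨ *-assoc (suc N) (suc N ^ j) (length Zs) ⟨
    suc N * suc N ^ j * length Zs        ∎)
    where
    open ≤-Reasoning
    rec = greedy N Zs j λ W lt → h W (m≤n⇒m≤1+n lt)
    W : FinSet n
    W = proj₁ rec
    size = proj₁ (proj₂ rec)
    pot = proj₂ (proj₂ rec)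
    room = h W (≤-reflexive (cong suc size))
    pick = below-average (λ v → potential (W ◂ v) Zs) (∁ W) {N} {suc N * potential W Zs} (proj₁ room)
      (average W N Zs (proj₂ room))
    v = proj₁ pick
    v∉W = proj₁ (proj₂ pick)
    le = proj₂ (proj₂ pick)
    eq₁ : ∀ N a p → N * a * p ≡ a * (N * p)
    eq₁ = solve-∀
    eq₂ : ∀ a s p → a * (s * p) ≡ s * (a * p)
    eq₂ = solve-∀

  -- The expected value of 2^|W ∩ Z| for a random W of size 6Dm is at most (4/3)^m, because
  -- |Z| ≤ n/(32D); the greedy choice of W derandomises the union bound.
  sparse-on-family : ∀ {D m} (Zs : List (FinSet n)) → 1 ≤ D → 1 ≤ m → 24 * D * m ≤ n →
    All (λ Z → 32 * D * # Z ≤ n) Zs → length Zs ^ 6 < 4 ^ m →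
    ∃ λ W → # W ≡ 6 * D * m × All (λ Z → # (W ∩ Z) < m) Zs
  sparse-on-family {suc d} {m@(suc _)} Zs 1≤D 1≤m large small few = W , size , potential<⇒ W m Zs (≰⇒> contra)
    where
    D = suc d
    N = 24 * D
    ℓ = length Zs
    room : ∀ (W : FinSet n) → # W < 6 * D * m → 3 * n ≤ 4 * # (∁ W)
    room W lt = linear 0 (≤-reflexive (cong (4 *_) (sym (#-∁ W))) ⊕ *-monoʳ-≤ 4 (<⇒≤ lt) ⊕ large)
      (eq n (# (∁ W)) (# W) D m)
      where
      eq : ∀ n c w D m → 4 * c + (4 * n + (4 * w + 24 * D * m)) ≡ 3 * n + (4 * (w + c) + (4 * (6 * D * m) + n)) + 0
      eq = solve-∀
    hyp : ∀ (W : FinSet n) → # W < 6 * D * m → 1 ≤ # (∁ W) × All (λ Z → N * # Z ≤ # (∁ W)) Zs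
    hyp W lt = nonempty , All.map (λ {Z} s → *-cancelˡ-≤ 4 (≤-trans (≤-reflexive (eq D (# Z)))
        (≤-trans (*-monoʳ-≤ 3 s) (room W lt)))) small
      where
      eq : ∀ D z → 4 * (24 * D * z) ≡ 3 * (32 * D * z)
      eq = solve-∀
      nonempty : 1 ≤ # (∁ W)
      nonempty with # (∁ W) in e
      ... | suc _ = s≤s z≤n
      ... | zero  = ⊥-elim (<⇒≱ (≤-trans (s≤s z≤n) large)
                      (*-cancelˡ-≤ 3 (≤-trans (room W lt) (≤-reflexive (cong (4 *_) e)))))
    g = greedy N Zs (6 * D * m) hyp
    W = proj₁ g
    size = proj₁ (proj₂ g)
    Φ = potential W Zs
    open ≤-Reasoning
    ^-swap : ∀ x a b → (x ^ a) ^ b ≡ (x ^ b) ^ a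
    ^-swap x a b = trans (^-*-assoc x a b) (trans (cong (x ^_) (*-comm a b)) (sym (^-*-assoc x b a)))
    pow : ∀ x → (x ^ (6 * D)) ^ m ≡ x ^ (6 * D * m)
    pow x = ^-*-assoc x (6 * D) m
    growth^ : 3 ^ m * suc N ^ (6 * D * m) ≤ 4 ^ m * N ^ (6 * D * m)
    growth^ = subst₂ _≤_ (trans (*-^ 3 (suc N ^ (6 * D)) m) (cong (3 ^ m *_) (pow (suc N))))
                         (trans (*-^ 4 (N ^ (6 * D)) m) (cong (4 ^ m *_) (pow N)))
                         (^-monoˡ-≤ m (growth D))
    potential-small : 3 ^ m * Φ ≤ 4 ^ m * ℓ
    potential-small = *-cancelˡ-≤ (N ^ (6 * D * m)) {{m^n≢0 N (6 * D * m)}} (begin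
      p * (3 ^ m * Φ)      ≡⟨ eq₁ p (3 ^ m) Φ ⟩
      3 ^ m * (p * Φ)      ≤⟨ *-monoʳ-≤ (3 ^ m) (proj₂ (proj₂ g)) ⟩
      3 ^ m * (q * ℓ)      ≡⟨ *-assoc (3 ^ m) q ℓ ⟨
      3 ^ m * q * ℓ        ≤⟨ *-monoˡ-≤ ℓ growth^ ⟩
      4 ^ m * p * ℓ        ≡⟨ eq₂ (4 ^ m) p ℓ ⟩
      p * (4 ^ m * ℓ)      ∎)
      where
      p = N ^ (6 * D * m)
      q = suc N ^ (6 * D * m)
      eq₁ : ∀ p a b → p * (a * b) ≡ a * (p * b)
      eq₁ = solve-∀
      eq₂ : ∀ a p b → a * p * b ≡ p * (a * b)
      eq₂ = solve-∀
    contra : 2 ^ m ≤ Φ → ⊥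
    contra le = <⇒≱ (begin-strict
      (4 ^ m * ℓ) ^ 6      ≡⟨ *-^ (4 ^ m) ℓ 6 ⟩
      (4 ^ m) ^ 6 * ℓ ^ 6  <⟨ *-monoʳ-< ((4 ^ m) ^ 6) {{m^n≢0 (4 ^ m) 6 {{m^n≢0 4 m}}}} few ⟩
      (4 ^ m) ^ 6 * 4 ^ m  ≡⟨ cong (_* 4 ^ m) (^-swap 4 m 6) ⟩
      (4 ^ 6) ^ m * 4 ^ m  ≡⟨ *-^ (4 ^ 6) 4 m ⟨
      (4 ^ 6 * 4) ^ m      ≤⟨ ^-monoˡ-≤ m (≤ᵇ⇒≤ (4 ^ 6 * 4) (6 ^ 6) _) ⟩
      (6 ^ 6) ^ m          ≡⟨ ^-swap 6 6 m ⟩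
      (6 ^ m) ^ 6          ∎) (^-monoˡ-≤ 6 (begin
        6 ^ m          ≡⟨ *-^ 3 2 m ⟩
        3 ^ m * 2 ^ m  ≤⟨ *-monoʳ-≤ (3 ^ m) le ⟩
        3 ^ m * Φ      ≤⟨ potential-small ⟩
        4 ^ m * ℓ      ∎))

length-cartesianProductWith : ∀ {A B C : Set} (f : A → B → C) xs ys →
  length (cartesianProductWith f xs ys) ≡ length xs * length ys
length-cartesianProductWith f []       ys = refl
length-cartesianProductWith f (x ∷ xs) ys = trans (length-++ (map (f x) ys))
  (cong₂ _+_ (length-map (f x) ys) (length-cartesianProductWith f xs ys))

tuples : ∀ {n} → ℕ → List (FinSet n)
tuples zero    = ∅ ∷ []
tuples (suc m) = cartesianProductWith (λ v X → X ◂ v) (allFin _) (tuples m)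

length-tuples : ∀ {n} m → length (tuples {n} m) ≡ n ^ m
length-tuples zero        = refl
length-tuples {n} (suc m) = trans (length-cartesianProductWith (λ v X → X ◂ v) (allFin n) (tuples m))
  (cong₂ _*_ (length-tabulate {n = n} _) (length-tuples m))

≗-intro : ∀ {n} {X Y : FinSet n} → X ⊆ Y → Y ⊆ X → X ≗ Y
≗-intro {X = X} {Y} s t i with bool (X i)
... | inj₁ p = trans p (sym (s i p))
... | inj₂ p = trans p (sym (≡false λ q → true≢false (t i q) p))

tuples-complete : ∀ {n} m (X : FinSet n) → # X ≡ m → ∃ λ Y → Y ∈ˡ tuples m × X ≗ Y
tuples-complete zero    X size = ∅ , here refl , λ i → ≡false λ p → <⇒≱ (#-mem X i p) (≤-reflexive size)
tuples-complete (suc m) X size with #-pos X (subst (1 ≤_) (sym size) (s≤s z≤n))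
... | v , v∈X = Y ◂ v , ∈-cartesianProductWith⁺ (λ v X → X ◂ v) (∈-allFin v) Y∈
  , λ i → trans (sym (restore i)) (cong (_∨ (i == v)) (X′≗Y i))
  where
  X′ : FinSet _
  X′ i = X i ∧ not (i == v)
  restore : (X′ ◂ v) ≗ X
  restore = ≗-intro sub sup
    where
    sub : (X′ ◂ v) ⊆ X
    sub i p with ◂-elim {X = X′} p
    ... | inj₁ q    = proj₁ (∧-elim {X i} q)
    ... | inj₂ refl = v∈X
    sup : X ⊆ (X′ ◂ v)
    sup i p with bool (i == v)
    ... | inj₁ e = ∨-introʳ {X′ i} e
    ... | inj₂ e = ∨-introˡ (∧-intro p (not-intro e))
  v∉X′ : X′ v ≡ false
  v∉X′ = ≡false λ p → true≢false (==-refl v) (not-elim (proj₂ (∧-elim {X v} p)))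
  rec = tuples-complete m X′ (suc-injective (trans (sym (#-◂ {X = X′} v∉X′)) (trans (weight-cong _ restore) size)))
  Y = proj₁ rec
  Y∈ = proj₁ (proj₂ rec)
  X′≗Y = proj₂ (proj₂ rec)

module _ {n} (H : Graph n) where

  nonneighbours : FinSet n → FinSet n
  nonneighbours X y = not (X y) ∧ not (Γ (adj H) X y)

  nonneighbours-intro : ∀ {X y} → (X y ≡ true → ⊥) → (∀ x → X x ≡ true → adj H x y ≡ true → ⊥) →
    nonneighbours X y ≡ true
  nonneighbours-intro {X} {y} y∉X h = ∧-intro (not-intro (≡false y∉X))
    (not-intro (≡false λ p → let (x , a , b) = Γ-elim {R = adj H} {X} p in h x a b))

  nonneighbours-elim : ∀ {X y} → nonneighbours X y ≡ true →
    X y ≡ false × (∀ x → X x ≡ true → adj H x y ≡ true → ⊥)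
  nonneighbours-elim {X} {y} p with ∧-elim {not (X y)} p
  ... | a , b = not-elim a , λ x q r → true≢false (Γ-intro {R = adj H} {X} q r) (not-elim b)

  expander-nonneighbours : ∀ {a b} → WeakExpander H a b → ∀ X → # X ≡ a → # (nonneighbours X) < b
  expander-nonneighbours {a} {b} ex X size = ≰⇒> λ le →
    let (Y , Y⊆ , Y#) = subset-of-size b (nonneighbours X) le
        (x , y , x∈ , y∈ , e) = ex (tabulate X) (tabulate Y)
          (λ i p q → true≢false (out X p) (proj₁ (nonneighbours-elim (Y⊆ i (out Y q)))))
          (trans (∣tabulate∣ X) size) (trans (∣tabulate∣ Y) Y#)
    in proj₂ (nonneighbours-elim (Y⊆ y (out Y y∈))) x (out X x∈) e
    where
    out : ∀ (X : FinSet n) {i} → i ∈ˢ tabulate X → X i ≡ true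
    out X {i} p = trans (sym (lookup∘tabulate X i)) ([]=⇒lookup p)

<ceilDiv⇒ : ∀ {a} k b → a < ceilDiv k b → suc b * a ≤ k
<ceilDiv⇒ {a} k b lt = linear 1 (≤-trans (*-monoˡ-≤ (suc b) lt) (m/n*n≤m (k + b) (suc b))) (eq k b a)
  where
  eq : ∀ k b a → k + suc a * suc b ≡ suc b * a + (k + b) + 1
  eq = solve-∀

-- The extension lemma

lower : ∀ {n} → (Fin n → ℕ) → Fin n → Fin n → ℕ
lower d x i = d i ∸ weigh (i == x) 1

lower≤ : ∀ {n} (d : Fin n → ℕ) x i → lower d x i ≤ d i
lower≤ d x i = m∸n≤m (d i) (weigh (i == x) 1)

lower-other : ∀ {n} (d : Fin n → ℕ) {x i} → (i ≡ x → ⊥) → lower d x i ≡ d i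
lower-other d {x} {i} ne rewrite ≡false {i == x} (ne ∘ ==-elim) = refl

lower-self : ∀ {n} (d : Fin n → ℕ) x → lower d x x ≡ d x ∸ 1
lower-self d x rewrite ==-refl x = refl

weight-lower : ∀ {n} (d : Fin n → ℕ) {x} {X : FinSet n} → 1 ≤ d x → X x ≡ true →
  suc (weight (lower d x) X) ≤ weight d X
weight-lower d {x} {X} pos x∈X = begin
  suc (weight (lower d x) X)                                ≡⟨ +-comm 1 _ ⟩
  weight (lower d x) X + 1                                  ≤⟨ +-monoʳ-≤ _ one ⟩
  weight (lower d x) X + weight (λ i → weigh (i == x) 1) X  ≡⟨ weight-sum-+ (lower d x) _ X ⟨
  weight (λ i → lower d x i + weigh (i == x) 1) X           ≤⟨ weight-mono {Y = X} (λ _ p → p) (λ i _ → back i) ⟩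
  weight d X                                                ∎
  where
  open ≤-Reasoning
  one : 1 ≤ weight (λ i → weigh (i == x) 1) X
  one = subst₂ _≤_ (trans (cong (λ b → weigh b _) x∈X) (cong (λ b → weigh b 1) (==-refl x)))
    (sym (weight-sum _ X)) (term≤sum (λ i → weigh (X i) (weigh (i == x) 1)) x)
  back : ∀ i → lower d x i + weigh (i == x) 1 ≤ d i
  back i with bool (i == x)
  ... | inj₁ e rewrite e | ==-elim e = ≤-reflexive (m∸n+n≡m pos)
  ... | inj₂ e rewrite e = ≤-reflexive (+-identityʳ (d i))

module _ {n} {R : Fin n → Fin n → Bool} where

  Γ-cong : ∀ {X Y : FinSet n} → X ≗ Y → Γ R X ≗ Γ R Y
  Γ-cong {X} {Y} h = ≗-intro
    (Γ-mono {R = R} {R} {X} {Y} (λ i p → trans (sym (h i)) p) λ _ _ _ r → r)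
    (Γ-mono {R = R} {R} {Y} {X} (λ i p → trans (h i) p) λ _ _ _ r → r)

  Γ-⊆ : ∀ {X Y : FinSet n} → X ⊆ Y → Γ R X ⊆ Γ R Y
  Γ-⊆ {X} {Y} s = Γ-mono {R = R} {R} {X} {Y} s λ _ _ _ r → r

  Γ-∪ : ∀ {X Y : FinSet n} y → Γ R (X ∪ Y) y ≡ true → Γ R X y ≡ true ⊎ Γ R Y y ≡ true
  Γ-∪ {X} {Y} y p with Γ-elim {R = R} {X ∪ Y} p
  ... | x , a , r with ∨-elim {X x} a
  ...   | inj₁ q = inj₁ (Γ-intro {R = R} q r)
  ...   | inj₂ q = inj₂ (Γ-intro {R = R} q r)

  Γ-submodular : ∀ (X Y : FinSet n) → # (Γ R (X ∪ Y)) + # (Γ R (X ∩ Y)) ≤ # (Γ R X) + # (Γ R Y)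
  Γ-submodular X Y = begin
    # (Γ R (X ∪ Y)) + # (Γ R (X ∩ Y))
      ≤⟨ +-mono-≤ (#-mono {Y = Γ R X ∪ Γ R Y} union) (#-mono {Y = Γ R X ∩ Γ R Y} inter) ⟩
    # (Γ R X ∪ Γ R Y) + # (Γ R X ∩ Γ R Y)  ≡⟨ weight-modular _ (Γ R X) (Γ R Y) ⟩
    # (Γ R X) + # (Γ R Y) ∎
    where
    open ≤-Reasoning
    union : Γ R (X ∪ Y) ⊆ (Γ R X ∪ Γ R Y)
    union y p with Γ-∪ {X} {Y} y p
    ... | inj₁ q = ∨-introˡ q
    ... | inj₂ q = ∨-introʳ {Γ R X y} q
    inter : Γ R (X ∩ Y) ⊆ (Γ R X ∩ Γ R Y)
    inter y p = ∧-intro (Γ-⊆ (λ i q → proj₁ (∧-elim {X i} q)) y p)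
      (Γ-⊆ {X ∩ Y} {Y} (λ i q → proj₂ (∧-elim {X i} q)) y p)

-- Friedman–Pippenger: if every choice of y were blocked, the blocking sets would be tight (weight d X = # Γ X);
-- by submodularity unions of tight sets are tight, and the union of all blockers together with x violates hall.
extension : ∀ {n} (R : Fin n → Fin n → Bool) (d : Fin n → ℕ) m x → 1 ≤ m → 1 ≤ d x →
  (∀ X → # X ≤ 2 * m → weight d X ≤ # (Γ R X)) →
  (∀ X → m < # X → # X ≤ 2 * m → weight d X < # (Γ R X)) →
  ∃ λ y → R x y ≡ true × (∀ X → # X ≤ 2 * m → weight (lower d x) X ≤ # (Γ R X ∖ (_== y)))
extension {n} R d m x 1≤m 1≤dx hall big with scan (allFin n)
  where
  open ≤-Reasoning
  Good : Fin n → FinSet n → Set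
  Good y X = # X ≤ 2 * m → weight (lower d x) X ≤ # (Γ R X ∖ (_== y))

  Tight : FinSet n → Set
  Tight U = # U ≤ m × # (Γ R U) ≤ weight d U × U x ≡ false

  good-or-blocked : ∀ y → (∀ X → Good y X) ⊎ ∃ λ X → ¬ Good y X
  good-or-blocked y = ∀-or-counterexample
    (λ X → (# X ≤? 2 * m) →-dec (weight (lower d x) X ≤? # (Γ R X ∖ (_== y))))
    λ X Y X≗Y g le → subst₂ _≤_ (weight-cong _ X≗Y)
      (weight-cong _ λ i → cong (_∧ not (i == y)) (Γ-cong {R = R} X≗Y i))
      (g (subst (_≤ 2 * m) (sym (weight-cong _ X≗Y)) le))

  small : ∀ X → # X ≤ 2 * m → # (Γ R X) ≤ weight d X → # X ≤ m
  small X le tight = ≮⇒≥ λ lt → <⇒≱ (big X lt le) tight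

  blocker : ∀ y X → ¬ Good y X → Tight X × Γ R X y ≡ true
  blocker y X bad with # X ≤? 2 * m | weight (lower d x) X ≤? # (Γ R X ∖ (_== y))
  ... | no ¬le | _      = ⊥-elim (bad λ le → ⊥-elim (¬le le))
  ... | _      | yes ok = ⊥-elim (bad λ _ → ok)
  ... | yes le | no ¬ok = (small X le tight , tight , x∉X) , y∈Γ
    where
    lost : # (Γ R X) ≤ suc (# (Γ R X ∖ (_== y)))
    lost = ≤-trans (#-cover {Y = Γ R X ∖ (_== y)} {_== y} split)
      (≤-reflexive (trans (cong (# (Γ R X ∖ (_== y)) +_) (#-single y)) (+-comm _ 1)))
      where
      split : ∀ i → Γ R X i ≡ true → (Γ R X ∖ (_== y)) i ≡ true ⊎ i == y ≡ true
      split i p with bool (i == y)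
      ... | inj₁ e = inj₂ e
      ... | inj₂ e = inj₁ (∧-intro p (not-intro e))
    tight : # (Γ R X) ≤ weight d X
    tight = ≤-trans lost (≤-trans (≰⇒> ¬ok) (weight-mono {Y = X} (λ _ p → p) λ i _ → lower≤ d x i))
    x∉X : X x ≡ false
    x∉X = ≡false λ p → ¬ok (≤-pred (≤-trans (weight-lower d 1≤dx p) (≤-trans (hall X le) lost)))
    y∈Γ : Γ R X y ≡ true
    y∈Γ with bool (Γ R X y)
    ... | inj₁ p = p
    ... | inj₂ p = ⊥-elim (¬ok (≤-trans (weight-mono {Y = X} (λ _ q → q) λ i _ → lower≤ d x i)
      (≤-trans (hall X le) (#-mono λ i q → ∧-intro q (not-intro (≡false λ e →
        true≢false (subst (λ z → Γ R X z ≡ true) (==-elim e) q) p))))))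

  merge : ∀ U X → Tight U → Tight X → Tight (U ∪ X)
  merge U X (U≤m , U-tight , x∉U) (X≤m , X-tight , x∉X) = small (U ∪ X) size tight , tight , cong₂ _∨_ x∉U x∉X
    where
    size : # (U ∪ X) ≤ 2 * m
    size = ≤-trans (weight-∪ _ U X) (subst (# U + # X ≤_) (cong (m +_) (sym (+-identityʳ m))) (+-mono-≤ U≤m X≤m))
    inter : weight d (U ∩ X) ≤ # (Γ R (U ∩ X))
    inter = hall (U ∩ X) (≤-trans (#-mono λ i p → proj₁ (∧-elim {U i} p)) (≤-trans U≤m (m≤m+n m _)))
    tight : # (Γ R (U ∪ X)) ≤ weight d (U ∪ X)
    tight = +-cancelʳ-≤ (weight d (U ∩ X)) _ _ (begin
      # (Γ R (U ∪ X)) + weight d (U ∩ X)       ≤⟨ +-monoʳ-≤ (# (Γ R (U ∪ X))) inter ⟩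
      # (Γ R (U ∪ X)) + # (Γ R (U ∩ X))        ≤⟨ Γ-submodular U X ⟩
      # (Γ R U) + # (Γ R X)                    ≤⟨ +-mono-≤ U-tight X-tight ⟩
      weight d U + weight d X                  ≡⟨ weight-modular d U X ⟨
      weight d (U ∪ X) + weight d (U ∩ X)      ∎)

  scan : (ys : List (Fin n)) → (∃ λ y → R x y ≡ true × ∀ X → Good y X) ⊎
    ∃ λ U → Tight U × (∀ y → y ∈ˡ ys → R x y ≡ true → Γ R U y ≡ true)
  scan [] = inj₂ (∅ , (≤-trans (≤-reflexive (weight-∅ _ λ _ ())) z≤n
    , ≤-trans (≤-reflexive (weight-∅ _ λ y p → let (_ , q , _) = Γ-elim {R = R} {∅} p in true≢false q refl)) z≤n
    , refl) , λ _ ())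
  scan (y ∷ ys) with scan ys | bool (R x y) | good-or-blocked y
  ... | inj₁ found | _ | _ = inj₁ found
  ... | inj₂ _ | inj₁ r | inj₁ g = inj₁ (y , r , g)
  ... | inj₂ (U , t , c) | inj₂ r | _ =
    inj₂ (U , t , λ { _ (here refl) p → true≢false p r ; z (there z∈) p → c z z∈ p })
  ... | inj₂ (U , t , c) | inj₁ r | inj₂ (X , bad) = inj₂ (U ∪ X , merge U X t (proj₁ (blocker y X bad)) ,
    λ { _ (here refl) _ → Γ-⊆ {R = R} {X} {U ∪ X} (λ i p → ∨-introʳ {U i} p) _ (proj₂ (blocker y X bad))
      ; z (there z∈) p → Γ-⊆ {R = R} {U} {U ∪ X} (λ i p → ∨-introˡ p) z (c z z∈ p) })
... | inj₁ found = found
... | inj₂ (U , (U≤m , tight , x∉U) , covers) = ⊥-elim (<⇒≱ (begin-strict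
    # (Γ R (U ◂ x))        ≤⟨ #-mono covered ⟩
    # (Γ R U)              ≤⟨ tight ⟩
    weight d U             <⟨ m<m+n _ 1≤dx ⟩
    weight d U + d x       ≡⟨ weight-◂ d {U} x∉U ⟨
    weight d (U ◂ x)       ∎)
    (hall (U ◂ x) (≤-trans (#-◂≤ U x) (≤-trans (+-mono-≤ 1≤m U≤m) (+-monoʳ-≤ m (m≤m+n m 0))))))
  where
  open ≤-Reasoning
  covered : Γ R (U ◂ x) ⊆ Γ R U
  covered y p with Γ-elim {R = R} {U ◂ x} p
  ... | z , z∈ , r with ◂-elim {X = U} z∈
  ...   | inj₁ q    = Γ-intro {R = R} q r
  ...   | inj₂ refl = covers y (∈-allFin y) r

-- Discarding the non-expanding vertices

#-split : ∀ {n} (X U : FinSet n) → # X ≤ # (X ∖ U) + # U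
#-split X U = #-cover {Y = X ∖ U} {U} split
  where
  split : ∀ i → X i ≡ true → (X ∖ U) i ≡ true ⊎ U i ≡ true
  split i p with bool (U i)
  ... | inj₁ u = inj₂ u
  ... | inj₂ u = inj₁ (∧-intro p (not-intro u))

-- Greedily collecting non-expanding sets stops early: for each colour the union of the sets collected
-- does not expand either, so it stays smaller than m₁.
module BadSet {n} (R : Bool → Fin n → Fin n → Bool) (E m₁ m₂ : ℕ)
  (1≤E : 1 ≤ E) (1≤m₁ : 1 ≤ m₁) (2m₁≤m₂ : 2 * m₁ ≤ m₂)
  (expand : ∀ c X → m₁ ≤ # X → # X ≤ 2 * m₂ → E * (2 * m₂) + 2 * m₁ ≤ # (Γ (R c) X)) where

  open ≤-Reasoning

  Expands : FinSet n → Bool → FinSet n → Set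
  Expands U c X = # X ≤ 2 * m₂ → E * # (X ∖ U) ≤ # (Γ (R c) (X ∖ U) ∖ U)

  either : (Bool → FinSet n) → FinSet n
  either B = B true ∪ B false

  record Bad (B : Bool → FinSet n) : Set where
    field
      size   : ∀ c → # (B c) < m₁
      narrow : ∀ c → # (Γ (R c) (B c) ∖ either B) ≤ E * # (B c)

  either-size : ∀ {B} → Bad B → # (either B) < 2 * m₁
  either-size {B} b = ≤-<-trans (weight-∪ _ (B true) (B false))
    (subst (# (B true) + # (B false) <_) (cong (m₁ +_) (sym (+-identityʳ m₁)))
      (+-mono-<-≤ (Bad.size b true) (<⇒≤ (Bad.size b false))))

  either-intro : ∀ {B : Bool → FinSet n} c {i} → B c i ≡ true → either B i ≡ true
  either-intro     true  p = ∨-introˡ p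
  either-intro {B} false {i} p = ∨-introʳ {B true i} p

  add : (Bool → FinSet n) → Bool → FinSet n → Bool → FinSet n
  add B true  Y true  = B true ∪ Y
  add B true  Y false = B false
  add B false Y true  = B true
  add B false Y false = B false ∪ Y

  add-self : ∀ B c Y → add B c Y c ≡ B c ∪ Y
  add-self B true  Y = refl
  add-self B false Y = refl

  add-other : ∀ B c Y → add B c Y (not c) ≡ B (not c)
  add-other B true  Y = refl
  add-other B false Y = refl

  add-old : ∀ B c Y c′ → B c′ ⊆ add B c Y c′
  add-old B true  Y true  i p = ∨-introˡ p
  add-old B true  Y false i p = p
  add-old B false Y true  i p = p
  add-old B false Y false i p = ∨-introˡ p

  either-add-size : ∀ B c Y → # (either (add B c Y)) ≤ # (B c ∪ Y) + # (B (not c))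
  either-add-size B true  Y = weight-∪ _ (B true ∪ Y) (B false)
  either-add-size B false Y = ≤-trans (weight-∪ _ (B true) (B false ∪ Y)) (≤-reflexive (+-comm (# (B true)) _))

  either-add : ∀ B c Y → (either B ∪ Y) ⊆ either (add B c Y)
  either-add B c Y i p with ∨-elim {either B i} p
  ... | inj₂ q = either-intro {add B c Y} c (subst (λ Z → Z i ≡ true) (sym (add-self B c Y)) (∨-introʳ {B c i} q))
  ... | inj₁ q with ∨-elim {B true i} q
  ...   | inj₁ r = either-intro {add B c Y} true (add-old B c Y true i r)
  ...   | inj₂ r = either-intro {add B c Y} false (add-old B c Y false i r)

  same-or-other : ∀ c c′ → c′ ≡ c ⊎ c′ ≡ not c
  same-or-other true  true  = inj₁ refl
  same-or-other true  false = inj₂ refl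
  same-or-other false true  = inj₂ refl
  same-or-other false false = inj₁ refl

  enlarge : ∀ {B} → Bad B → ∀ c X → ¬ Expands (either B) c X → ∃ λ B′ → Bad B′ × # (either B) < # (either B′)
  enlarge {B} bad c X ¬exp with # X ≤? 2 * m₂ | E * # (X ∖ either B) ≤? # (Γ (R c) (X ∖ either B) ∖ either B)
  ... | no ¬le | _      = ⊥-elim (¬exp λ le → ⊥-elim (¬le le))
  ... | _      | yes ok = ⊥-elim (¬exp λ _ → ok)
  ... | yes le | no ¬ok = B′ , record { size = size′ ; narrow = narrow′ } , grows
    where
    U = either B
    Y = X ∖ U
    B′ = add B c Y
    U′ = either B′
    Y-narrow : # (Γ (R c) Y ∖ U) < E * # Y
    Y-narrow = ≰⇒> ¬ok
    #Y≤ : # Y ≤ 2 * m₂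
    #Y≤ = ≤-trans (#-mono λ i p → proj₁ (∧-elim {X i} p)) le
    disjoint : ∀ i → U i ≡ true → Y i ≡ true → ⊥
    disjoint i u y = true≢false u (not-elim (proj₂ (∧-elim {X i} y)))
    #Y<m₁ : # Y < m₁
    #Y<m₁ = ≰⇒> λ m₁≤ → <⇒≱ Y-narrow (begin
      E * # Y          ≤⟨ *-monoʳ-≤ E #Y≤ ⟩
      E * (2 * m₂)     ≤⟨ +-cancelʳ-≤ (2 * m₁) _ _ (begin
        E * (2 * m₂) + 2 * m₁           ≤⟨ expand c Y m₁≤ #Y≤ ⟩
        # (Γ (R c) Y)                   ≤⟨ #-split (Γ (R c) Y) U ⟩
        # (Γ (R c) Y ∖ U) + # U         ≤⟨ +-monoʳ-≤ _ (<⇒≤ (either-size bad)) ⟩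
        # (Γ (R c) Y ∖ U) + 2 * m₁      ∎) ⟩
      # (Γ (R c) Y ∖ U) ∎)
    Z = B c ∪ Y
    #Z : # Z ≡ # (B c) + # Y
    #Z = weight-disjoint _ (B c) Y λ i b → disjoint i (either-intro {B} c b)
    #Z≤ : # Z ≤ 2 * m₁
    #Z≤ = subst₂ _≤_ (sym #Z) (cong (m₁ +_) (sym (+-identityʳ m₁)))
      (+-mono-≤ (<⇒≤ (Bad.size bad c)) (<⇒≤ #Y<m₁))
    Z-narrow : # (Γ (R c) Z ∖ U′) ≤ E * # Z
    Z-narrow = begin
      # (Γ (R c) Z ∖ U′)                               ≤⟨ #-cover {Y = Γ (R c) (B c) ∖ U} {Γ (R c) Y ∖ U} split ⟩
      # (Γ (R c) (B c) ∖ U) + # (Γ (R c) Y ∖ U)        ≤⟨ +-mono-≤ (Bad.narrow bad c) (<⇒≤ Y-narrow) ⟩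
      E * # (B c) + E * # Y                            ≡⟨ *-distribˡ-+ E _ _ ⟨
      E * (# (B c) + # Y)                              ≡⟨ cong (E *_) #Z ⟨
      E * # Z                                          ∎
      where
      outside : ∀ i → not (U′ i) ≡ true → not (U i) ≡ true
      outside i p = not-intro (≡false λ u → true≢false (either-add B c Y i (∨-introˡ u)) (not-elim p))
      split : ∀ i → (Γ (R c) Z ∖ U′) i ≡ true → (Γ (R c) (B c) ∖ U) i ≡ true ⊎ (Γ (R c) Y ∖ U) i ≡ true
      split i p with ∧-elim {Γ (R c) Z i} p
      ... | q , r with Γ-∪ {R = R c} {B c} {Y} i q
      ...   | inj₁ s = inj₁ (∧-intro s (outside i r))
      ...   | inj₂ s = inj₂ (∧-intro s (outside i r))
    #Z<m₁ : # Z < m₁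
    #Z<m₁ = ≰⇒> λ m₁≤ → <⇒≱ (m<m+n (E * (2 * m₁) + 3 * m₁) 1≤m₁) (linear 0
      (expand c Z m₁≤ (≤-trans #Z≤ (≤-trans 2m₁≤m₂ (m≤m+n m₂ _)))
        ⊕ #-split (Γ (R c) Z) U′ ⊕ Z-narrow ⊕ *-monoʳ-≤ E #Z≤ ⊕ either-add-size B c Y ⊕ #Z≤
        ⊕ <⇒≤ (Bad.size bad (not c)) ⊕ *-monoʳ-≤ E (*-monoʳ-≤ 2 2m₁≤m₂) ⊕ *-monoˡ-≤ (2 * m₁) 1≤E)
      (eq E m₁ m₂ (# (Γ (R c) Z)) (# (Γ (R c) Z ∖ U′)) (# U′) (# Z) (# (B (not c)))))
      where
      eq : ∀ E m₁ m₂ g h u z b →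
        E * (2 * m₁) + 3 * m₁
          + (E * (2 * m₂) + 2 * m₁ + (g + (h + (E * z + (u + (z + (b + (E * (2 * (2 * m₁)) + 1 * (2 * m₁)))))))))
        ≡ E * (2 * m₁) + 3 * m₁ + m₁
          + (g + (h + u + (E * z + (E * (2 * m₁) + (z + b + (2 * m₁ + (m₁ + (E * (2 * m₂) + E * (2 * m₁))))))))) + 0
      eq = solve-∀
    size′ : ∀ c′ → # (B′ c′) < m₁
    size′ c′ with same-or-other c c′
    ... | inj₁ refl = subst (λ S → # S < m₁) (sym (add-self B c′ Y)) #Z<m₁
    ... | inj₂ refl = subst (λ S → # S < m₁) (sym (add-other B c Y)) (Bad.size bad (not c))
    narrow′ : ∀ c′ → # (Γ (R c′) (B′ c′) ∖ U′) ≤ E * # (B′ c′)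
    narrow′ c′ with same-or-other c c′
    ... | inj₁ refl = subst (λ S → # (Γ (R c′) S ∖ U′) ≤ E * # S) (sym (add-self B c′ Y)) Z-narrow
    ... | inj₂ refl = subst (λ S → # (Γ (R (not c)) S ∖ U′) ≤ E * # S) (sym (add-other B c Y))
      (≤-trans (#-mono λ i p → let (q , r) = ∧-elim {Γ (R (not c)) (B (not c)) i} p in
        ∧-intro q (not-intro (≡false λ u → true≢false (either-add B c Y i (∨-introˡ u)) (not-elim r))))
      (Bad.narrow bad (not c)))
    grows : # U < # U′
    grows = begin-strict
      # U          <⟨ m<m+n (# U) #Y≥1 ⟩
      # U + # Y    ≡⟨ weight-disjoint _ U Y disjoint ⟨
      # (U ∪ Y)    ≤⟨ #-mono (either-add B c Y) ⟩
      # U′         ∎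
      where
      #Y≥1 : 1 ≤ # Y
      #Y≥1 with # Y | Y-narrow
      ... | suc _ | _  = s≤s z≤n
      ... | zero  | lt = ⊥-elim (<⇒≱ lt (≤-trans (≤-reflexive (*-zeroʳ E)) z≤n))

  Expands-dec : ∀ U c X → Dec (Expands U c X)
  Expands-dec U c X = (# X ≤? 2 * m₂) →-dec (E * # (X ∖ U) ≤? # (Γ (R c) (X ∖ U) ∖ U))

  Expands-resp : ∀ U c X Y → X ≗ Y → Expands U c X → Expands U c Y
  Expands-resp U c X Y X≗Y e le = subst₂ _≤_ (cong (E *_) (weight-cong _ diff))
    (weight-cong _ λ i → cong (_∧ not (U i)) (Γ-cong {R = R c} diff i))
    (e (subst (_≤ 2 * m₂) (sym (weight-cong _ X≗Y)) le))
    where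
    diff : (X ∖ U) ≗ (Y ∖ U)
    diff i = cong (_∧ not (U i)) (X≗Y i)

  search : ∀ fuel {B} → Bad B → 2 * m₁ ≤ fuel + # (either B) →
    ∃ λ U → # U ≤ 2 * m₁ × ∀ c X → Expands U c X
  search zero       bad le = ⊥-elim (<⇒≱ (either-size bad) le)
  search (suc fuel) {B} bad le
    with ∀-or-counterexample (Expands-dec (either B) true) (Expands-resp (either B) true)
       | ∀-or-counterexample (Expands-dec (either B) false) (Expands-resp (either B) false)
  ... | inj₁ p | inj₁ q = either B , <⇒≤ (either-size bad) , λ { true → p ; false → q }
  ... | inj₂ (X , ¬e) | _ = let (_ , bad′ , lt) = enlarge bad true X ¬e in
    search fuel bad′ (≤-trans le (≤-trans (≤-reflexive (sym (+-suc fuel _))) (+-monoʳ-≤ fuel lt)))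
  ... | inj₁ _ | inj₂ (X , ¬e) = let (_ , bad′ , lt) = enlarge bad false X ¬e in
    search fuel bad′ (≤-trans le (≤-trans (≤-reflexive (sym (+-suc fuel _))) (+-monoʳ-≤ fuel lt)))

  bad-set : ∃ λ U → # U ≤ 2 * m₁ × ∀ c X → Expands U c X
  bad-set = search (2 * m₁) {λ _ → ∅} (record
    { size   = λ c → ≤-trans (≤-reflexive (cong suc (weight-∅ _ λ _ ()))) 1≤m₁
    ; narrow = λ c → ≤-trans (≤-reflexive (weight-∅ _ λ i p →
        let (_ , q , _) = Γ-elim {R = R c} {∅} (proj₁ (∧-elim {Γ (R c) ∅ i} p)) in true≢false q refl)) z≤n })
    (m≤m+n _ _)

-- Trees

lookup-injective : ∀ {A : Set} {xs : List A} → Unique xs → ∀ i j → lookup xs i ≡ lookup xs j → i ≡ j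
lookup-injective (_ ∷ _) zero    zero    _ = refl
lookup-injective (h ∷ _) zero    (suc j) e = ⊥-elim (All.lookup h (∈-lookup j) e)
lookup-injective (h ∷ _) (suc i) zero    e = ⊥-elim (All.lookup h (∈-lookup i) (sym e))
lookup-injective (_ ∷ u) (suc i) (suc j) e = cong suc (lookup-injective u i j e)

module _ {k} (T : Graph k) where

  data WalkIn (S : FinSet k) : Fin k → Fin k → Set where
    stay : ∀ {u} → S u ≡ true → WalkIn S u u
    move : ∀ {u w v} → S u ≡ true → adj T u w ≡ true → WalkIn S w v → WalkIn S u v

  -- The list holds the vertices after the first one.
  data Chain (S : FinSet k) : Fin k → List (Fin k) → Fin k → Set where
    end  : ∀ {u} → S u ≡ true → Chain S u [] u
    link : ∀ {u w v xs} → S u ≡ true → adj T u w ≡ true → Chain S w xs v → Chain S u (w ∷ xs) v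

  module _ {S : FinSet k} where

    suffix : ∀ {u w v xs} → Chain S w xs v → Unique (w ∷ xs) → u ∈ˡ (w ∷ xs) →
      ∃ λ ys → Chain S u ys v × Unique (u ∷ ys)
    suffix c            un       (here refl) = _ , c , un
    suffix (link _ _ c) (_ ∷ un) (there u∈)  = suffix c un u∈

    simple : ∀ {u v} → WalkIn S u v → ∃ λ xs → Chain S u xs v × Unique (u ∷ xs)
    simple (stay s) = [] , end s , [] ∷ []
    simple {u} (move {w = w} s e walk) with simple walk
    ... | xs , c , un with any? (u ≟ᶠ_) (w ∷ xs)
    ...   | yes u∈ = suffix c un u∈
    ...   | no u∉  = w ∷ xs , link s e c , All.¬Any⇒All¬ (w ∷ xs) u∉ ∷ un

    chain-adjacent : ∀ {u v xs} → Chain S u xs v → ∀ i → adj T (lookup (u ∷ xs) (inject₁ i)) (lookup xs i) ≡ true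
    chain-adjacent (link _ e c) zero    = e
    chain-adjacent (link _ e c) (suc i) = chain-adjacent c i

    chain-last : ∀ {u v xs} → Chain S u xs v → lookup (u ∷ xs) (fromℕ (length xs)) ≡ v
    chain-last (end _)      = refl
    chain-last (link _ _ c) = chain-last c

    chain-inside : ∀ {u v xs} → Chain S u xs v → All (λ z → S z ≡ true) (u ∷ xs)
    chain-inside (end s)      = s ∷ []
    chain-inside (link s _ c) = s ∷ chain-inside c

    unique-attachment : Acyclic T → ∀ {t u v} → S t ≡ false → WalkIn S u v →
      adj T u t ≡ true → adj T v t ≡ true → u ≡ v
    unique-attachment acyclic {t} {u} {v} t∉S walk ut vt with simple walk
    ... | []     , end _ , _ = refl
    ... | y ∷ ys , c , un = ⊥-elim (acyclic record
      { l      = length ys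
      ; c      = lookup (t ∷ u ∷ y ∷ ys)
      ; inj    = λ {i} {j} → lookup-injective (All.map t≢ (chain-inside c) ∷ un) i j
      ; consec = λ { zero → trans (adj-sym T t u) ut ; (suc i) → chain-adjacent c i }
      ; close  = subst (λ z → adj T z t ≡ true) (sym (chain-last c)) vt })
      where
      t≢ : ∀ {z} → S z ≡ true → t ≢ z
      t≢ z∈S refl = true≢false z∈S t∉S

    walkIn-append : ∀ {u w v} → WalkIn S u w → WalkIn S w v → WalkIn S u v
    walkIn-append (stay _)     q = q
    walkIn-append (move s e p) q = move s e (walkIn-append p q)

  walkIn-mono : ∀ {S S′ u v} → S ⊆ S′ → WalkIn S u v → WalkIn S′ u v
  walkIn-mono h (stay s)     = stay (h _ s)
  walkIn-mono h (move s e p) = move (h _ s) e (walkIn-mono h p)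

  ConnectedOn : FinSet k → Set
  ConnectedOn S = ∀ u v → S u ≡ true → S v ≡ true → WalkIn S u v

  connectedOn-single : ∀ r → ConnectedOn (∅ ◂ r)
  connectedOn-single r u v p q with ==-elim {i = u} p | ==-elim {i = v} q
  ... | refl | refl = stay p

  connectedOn-◂ : ∀ {S p t} → ConnectedOn S → S p ≡ true → adj T p t ≡ true → ConnectedOn (S ◂ t)
  connectedOn-◂ {S} {p} {t} con p∈S pt u v u∈ v∈ with ◂-elim {X = S} u∈ | ◂-elim {X = S} v∈
  ... | inj₁ a    | inj₁ b    = walkIn-mono (λ i → ◂-old {X = S}) (con u v a b)
  ... | inj₁ a    | inj₂ refl = walkIn-append (walkIn-mono (λ i → ◂-old {X = S}) (con u p a p∈S))
                                  (move (◂-old {X = S} p∈S) pt (stay v∈))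
  ... | inj₂ refl | inj₁ b    = move u∈ (trans (adj-sym T t p) pt) (walkIn-mono (λ i → ◂-old {X = S}) (con p v p∈S b))
  ... | inj₂ refl | inj₂ refl = stay u∈

  leaf inner : FinSet k
  leaf t = isOne T (degree T t)
  inner t = not (leaf t)

  degree≡ : ∀ t → degree T t ≡ # (adj T t)
  degree≡ t = ∣tabulate∣ (adj T t)

  leaves≡ : leaves T ≡ # leaf
  leaves≡ = ∣tabulate∣ leaf

  leaf-degree : ∀ {t} → leaf t ≡ true → # (adj T t) ≡ 1
  leaf-degree {t} p = trans (sym (degree≡ t)) (isOne⇒ p)
    where
    isOne⇒ : ∀ {d} → isOne T d ≡ true → d ≡ 1
    isOne⇒ {suc zero} _ = refl

  inner-degree : ∀ {t} → inner t ≡ true → 1 ≤ # (adj T t) → 2 ≤ # (adj T t)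
  inner-degree {t} p le = subst (2 ≤_) (degree≡ t) (≥2 (not-elim p) (subst (1 ≤_) (sym (degree≡ t)) le))
    where
    ≥2 : ∀ {d} → isOne T d ≡ false → 1 ≤ d → 2 ≤ d
    ≥2 {suc (suc d)} _ _ = s≤s (s≤s z≤n)

  leaf-unique : ∀ {t u v} → leaf t ≡ true → adj T t u ≡ true → adj T t v ≡ true → u ≡ v
  leaf-unique {t} {u} {v} p = unique-of-#1 (adj T t) (leaf-degree p) u v

  leaf-neighbour : ∀ {t} → leaf t ≡ true → ∃ λ p → adj T t p ≡ true
  leaf-neighbour {t} p = #-pos (adj T t) (≤-reflexive (sym (leaf-degree p)))

  module Tree (connected : Connected T) (3≤leaves : 3 ≤ # leaf) where

    leaves-not-adjacent : ∀ {u w} → leaf u ≡ true → leaf w ≡ true → adj T u w ≡ true → ⊥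
    leaves-not-adjacent {u} {w} u-leaf w-leaf uw = <⇒≱ 3≤leaves (begin
      # leaf               ≤⟨ #-mono {Y = (_== u) ◂ w} (λ v _ → inside (connected u v) (inj₁ refl)) ⟩
      # ((_== u) ◂ w)      ≤⟨ #-◂≤ (_== u) w ⟩
      suc (# (_== u))      ≡⟨ cong suc (#-single u) ⟩
      2                    ∎)
      where
      open ≤-Reasoning
      inside : ∀ {a v} → Walk T a v → a ≡ u ⊎ a ≡ w → ((_== u) ◂ w) v ≡ true
      inside here (inj₁ refl) = ◂-old {X = _== u} (==-refl u)
      inside here (inj₂ refl) = ◂-new {X = _== u}
      inside (step e walk) (inj₁ refl) = inside walk (inj₂ (leaf-unique u-leaf e uw))
      inside (step e walk) (inj₂ refl) = inside walk (inj₁ (leaf-unique w-leaf e (trans (adj-sym T w u) uw)))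

    leaf-neighbour-inner : ∀ {u w} → leaf u ≡ true → adj T u w ≡ true → inner w ≡ true
    leaf-neighbour-inner u-leaf uw = not-intro (≡false λ w-leaf → leaves-not-adjacent u-leaf w-leaf uw)

    inner-with-neighbour : ∃ λ r → inner r ≡ true × 2 ≤ # (adj T r)
    inner-with-neighbour =
      let (l , l-leaf) = #-pos leaf (≤-trans (s≤s z≤n) 3≤leaves)
          (r , lr) = leaf-neighbour l-leaf
          r-inner = leaf-neighbour-inner l-leaf lr
      in r , r-inner , inner-degree r-inner (#-mem (adj T r) l (trans (adj-sym T r l) lr))

    attach-inner : ∀ {S : FinSet k} {a t} → S a ≡ true → Walk T a t → inner t ≡ true → S t ≡ false →
      ∃ λ p → ∃ λ u → S p ≡ true × S u ≡ false × inner u ≡ true × adj T p u ≡ true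
    attach-inner a∈ here t-inner t∉ = true≢false a∈ t∉
    attach-inner {S} {a} a∈ (step {w = w} aw walk) t-inner t∉ with bool (S w) | bool (leaf w)
    ... | inj₁ w∈ | _ = attach-inner w∈ walk t-inner t∉
    ... | inj₂ w∉ | inj₂ w-inner = a , w , a∈ , w∉ , not-intro w-inner , aw
    attach-inner {S} {a} a∈ (step {w = w} aw here) t-inner t∉ | inj₂ w∉ | inj₁ w-leaf =
      true≢false w-leaf (not-elim t-inner)
    attach-inner {S} {a} a∈ (step {w = w} aw (step {w = w′} ww′ walk)) t-inner t∉ | inj₂ w∉ | inj₁ w-leaf =
      attach-inner (subst (λ z → S z ≡ true) (leaf-unique w-leaf (trans (adj-sym T w a) aw) ww′) a∈) walk t-inner t∉

    parent : FinSet k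
    parent p = inner p ∧ some λ l → leaf l ∧ adj T p l

    leaves≤parents : ∀ {D} → MaxDegreeAtMost T D → # leaf ≤ D * # parent
    leaves≤parents {D} max = begin
      # leaf                                  ≤⟨ #≤sum leaf (λ l p → let (q , e) = leaf-neighbour p in
                                                   #-mem _ q (∧-intro p (trans (adj-sym T q l) e))) ⟩
      sum (λ l → # (λ p → leaf l ∧ adj T p l)) ≡⟨ double-count (λ l p → leaf l ∧ adj T p l) ⟩
      sum (λ p → # (λ l → leaf l ∧ adj T p l)) ≤⟨ sum-mono children ⟩
      sum (λ p → weigh (parent p) D)          ≡⟨ weight-sum (λ _ → D) parent ⟨
      weight (λ _ → D) parent                 ≤⟨ weight≤* D parent (λ _ → ≤-refl) ⟩
      D * # parent                            ∎
      where
      open ≤-Reasoning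
      children : ∀ p → # (λ l → leaf l ∧ adj T p l) ≤ weigh (parent p) D
      children p with bool (parent p)
      ... | inj₁ q rewrite q = ≤-trans (#-mono λ l r → proj₂ (∧-elim {leaf l} r)) (subst (_≤ D) (degree≡ p) (max p))
      ... | inj₂ q = ≤-trans (≤-reflexive (weight-∅ _ λ l r → let (l-leaf , pl) = ∧-elim {leaf l} r in
        true≢false (∧-intro (leaf-neighbour-inner l-leaf (trans (adj-sym T l p) pl)) (some-intro _ l r)) q)) z≤n

-- Partial embeddings

image : ∀ {k n} → FinSet k → (Fin k → Fin n) → FinSet n
image S φ y = some λ t → S t ∧ (φ t == y)

image-intro : ∀ {k n} {S : FinSet k} {φ : Fin k → Fin n} {t} → S t ≡ true → image S φ (φ t) ≡ true
image-intro {φ = φ} {t} p = some-intro _ t (∧-intro p (==-refl (φ t)))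

image-elim : ∀ {k n} {S : FinSet k} {φ : Fin k → Fin n} {y} → image S φ y ≡ true →
  ∃ λ t → S t ≡ true × φ t ≡ y
image-elim {S = S} p = let (t , q) = some-elim _ p ; (a , b) = ∧-elim {S t} q in t , a , ==-elim b

redirect : ∀ {k n} → (Fin k → Fin n) → Fin k → Fin n → Fin k → Fin n
redirect φ t y u = if u == t then y else φ u

redirect-new : ∀ {k n} (φ : Fin k → Fin n) t y → redirect φ t y t ≡ y
redirect-new φ t y rewrite ==-refl t = refl

redirect-old : ∀ {k n} (φ : Fin k → Fin n) {t y u} → (u ≡ t → ⊥) → redirect φ t y u ≡ φ u
redirect-old φ {t} {y} {u} ne rewrite ≡false {u == t} (ne ∘ ==-elim) = refl

remaining : ∀ {k} → Graph k → FinSet k → Fin k → ℕ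
remaining T S t = # (λ u → not (S u) ∧ adj T t u)

module Embedding {n k} (H : Graph n) (T : Graph k) {K : Set} (avail : K → FinSet n)
  (avail-disjoint : ∀ {c c′} v → avail c v ≡ true → avail c′ v ≡ true → c ≡ c′)
  (colour : Fin k → K) (B : FinSet n) (m E : ℕ) (d₀ : Fin n → ℕ) where

  free : K → FinSet k → (Fin k → Fin n) → Fin n → Fin n → Bool
  free c S φ x y = adj H x y ∧ (avail c y ∧ (not (B y) ∧ not (image S φ y)))

  free-intro : ∀ {c S φ x y} → adj H x y ≡ true → avail c y ≡ true → B y ≡ false → image S φ y ≡ false →
    free c S φ x y ≡ true
  free-intro a b p q = ∧-intro a (∧-intro b (∧-intro (not-intro p) (not-intro q)))

  free-elim : ∀ {c S φ x y} → free c S φ x y ≡ true →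
    adj H x y ≡ true × avail c y ≡ true × B y ≡ false × image S φ y ≡ false
  free-elim {c} {S} {φ} {x} {y} p =
    let (a , p₁) = ∧-elim {adj H x y} p
        (b , p₂) = ∧-elim {avail c y} p₁
        (e , f)  = ∧-elim {not (B y)} p₂
    in a , b , not-elim e , not-elim f

  -- d x bounds from below the number of further neighbours of x that can be reserved simultaneously,
  -- in each colour, and d (φ t) is at least the number of children of t still to be embedded.
  record State (S : FinSet k) : Set where
    field
      φ     : Fin k → Fin n
      d     : Fin n → ℕ
      inj   : ∀ s t → S s ≡ true → S t ≡ true → φ s ≡ φ t → s ≡ t
      hom   : ∀ s t → S s ≡ true → S t ≡ true → adj T s t ≡ true → adj H (φ s) (φ t) ≡ true
      cls   : ∀ t → S t ≡ true → avail (colour t) (φ t) ≡ true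
      hall  : ∀ c X → # X ≤ 2 * m → weight d X ≤ # (Γ (free c S φ) X)
      dem   : ∀ t → S t ≡ true → remaining T S t ≤ d (φ t)
      fresh : ∀ v → B v ≡ false → image S φ v ≡ false → E ≤ d v
      bound : ∀ v → d v ≤ d₀ v

  open State

  Large : ∀ {S} → State S → K → Set
  Large {S} st c = ∀ X → m < # X → # X ≤ 2 * m → weight (d st) X < # (Γ (free c S (φ st)) X)

  place : ∀ {S} (st : State S) t x → 1 ≤ m → S t ≡ false → 1 ≤ d st x → Large st (colour t) →
    (∀ s → S s ≡ true → adj T s t ≡ true → φ st s ≡ x) →
    (∀ s → S s ≡ true → remaining T (S ◂ t) s ≤ lower (d st) x (φ st s)) →
    (∀ v → B v ≡ false → image S (φ st) v ≡ false → E ≤ lower (d st) x v) →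
    remaining T (S ◂ t) t ≤ E → State (S ◂ t)
  place {S} st t x 1≤m t∉S 1≤dx large attached dem′ fresh′ rem≤E = record
    { φ     = φ′
    ; d     = d′
    ; inj   = inj′
    ; hom   = hom′
    ; cls   = cls′
    ; hall  = hall′
    ; dem   = dem″
    ; fresh = λ v b i → fresh′ v b (image-old v i)
    ; bound = λ v → ≤-trans (lower≤ (d st) x v) (bound st v) }
    where
    ext = extension (free (colour t) S (φ st)) (d st) m x 1≤m 1≤dx (hall st (colour t)) large
    y = proj₁ ext
    reserve = proj₂ (proj₂ ext)
    y-free = free-elim {colour t} {S} {φ st} (proj₁ (proj₂ ext))
    xy = proj₁ y-free
    y-avail = proj₁ (proj₂ y-free)
    y∉B = proj₁ (proj₂ (proj₂ y-free))
    y∉im = proj₂ (proj₂ (proj₂ y-free))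
    φ′ = redirect (φ st) t y
    d′ = lower (d st) x
    S′ = S ◂ t
    old : ∀ {s} → S s ≡ true → φ′ s ≡ φ st s
    old s∈S = redirect-old (φ st) λ { refl → true≢false s∈S t∉S }
    new : φ′ t ≡ y
    new = redirect-new (φ st) t y
    fresh-y : ∀ {s} → S s ≡ true → φ st s ≡ y → ⊥
    fresh-y s∈S e = true≢false (subst (λ z → image S (φ st) z ≡ true) e (image-intro {S = S} {φ st} s∈S)) y∉im
    image-old : ∀ v → image S′ φ′ v ≡ false → image S (φ st) v ≡ false
    image-old v p = ≡false λ q → let (s , s∈S , e) = image-elim {S = S} {φ st} q in
      true≢false (subst (λ z → image S′ φ′ z ≡ true) (trans (old s∈S) e)
        (image-intro {S = S′} {φ′} (◂-old {X = S} s∈S))) p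
    image-new : ∀ v → image S (φ st) v ≡ false → (v ≡ y → ⊥) → image S′ φ′ v ≡ false
    image-new v p v≢y = ≡false λ q → let (s , s∈ , e) = image-elim {S = S′} {φ′} q in case s s∈ e
      where
      case : ∀ s → S′ s ≡ true → φ′ s ≡ v → ⊥
      case s s∈ e with ◂-elim {X = S} s∈
      ... | inj₁ s∈S  = true≢false (subst (λ z → image S (φ st) z ≡ true) (trans (sym (old s∈S)) e)
        (image-intro {S = S} {φ st} s∈S)) p
      ... | inj₂ refl = v≢y (trans (sym e) new)
    inj′ : ∀ s u → S′ s ≡ true → S′ u ≡ true → φ′ s ≡ φ′ u → s ≡ u
    inj′ s u s∈ u∈ e with ◂-elim {X = S} s∈ | ◂-elim {X = S} u∈
    ... | inj₁ a    | inj₁ b    = inj st s u a b (trans (sym (old a)) (trans e (old b)))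
    ... | inj₁ a    | inj₂ refl = ⊥-elim (fresh-y a (trans (sym (old a)) (trans e new)))
    ... | inj₂ refl | inj₁ b    = ⊥-elim (fresh-y b (trans (sym (old b)) (trans (sym e) new)))
    ... | inj₂ refl | inj₂ refl = refl
    hom′ : ∀ s u → S′ s ≡ true → S′ u ≡ true → adj T s u ≡ true → adj H (φ′ s) (φ′ u) ≡ true
    hom′ s u s∈ u∈ e with ◂-elim {X = S} s∈ | ◂-elim {X = S} u∈
    ... | inj₁ a    | inj₁ b    = subst₂ (λ v w → adj H v w ≡ true) (sym (old a)) (sym (old b)) (hom st s u a b e)
    ... | inj₁ a    | inj₂ refl = subst₂ (λ v w → adj H v w ≡ true) (sym (trans (old a) (attached s a e))) (sym new) xy
    ... | inj₂ refl | inj₁ b    = subst₂ (λ v w → adj H v w ≡ true) (sym new)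
      (sym (trans (old b) (attached u b (trans (adj-sym T u t) e)))) (trans (adj-sym H y x) xy)
    ... | inj₂ refl | inj₂ refl = true≢false e (irrefl T s)
    cls′ : ∀ s → S′ s ≡ true → avail (colour s) (φ′ s) ≡ true
    cls′ s s∈ with ◂-elim {X = S} s∈
    ... | inj₁ a    = subst (λ v → avail (colour s) v ≡ true) (sym (old a)) (cls st s a)
    ... | inj₂ refl = subst (λ v → avail (colour s) v ≡ true) (sym new) y-avail
    still-free : ∀ c v w → free c S (φ st) v w ≡ true → (w ≡ y → ⊥) → free c S′ φ′ v w ≡ true
    still-free c v w p w≢y = let (a , b , e , f) = free-elim {c} {S} {φ st} p in
      free-intro {c} {S′} {φ′} a b e (image-new w f w≢y)
    hall′ : ∀ c X → # X ≤ 2 * m → weight d′ X ≤ # (Γ (free c S′ φ′) X)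
    hall′ c X le with bool (avail c y)
    ... | inj₁ p with avail-disjoint y p y-avail
    ...   | refl = ≤-trans (reserve X le) (#-mono λ w q → let (a , b) = ∧-elim {Γ (free c S (φ st)) X w} q
                                                              (v , v∈ , r) = Γ-elim {R = free c S (φ st)} {X} a in
      Γ-intro {R = free c S′ φ′} v∈ (still-free c v w r λ e → true≢false (==-intro e) (not-elim b)))
    hall′ c X le | inj₂ p = ≤-trans (weight-mono {Y = X} (λ _ q → q) λ i _ → lower≤ (d st) x i)
      (≤-trans (hall st c X le) (#-mono λ w q → let (v , v∈ , r) = Γ-elim {R = free c S (φ st)} {X} q in
        Γ-intro {R = free c S′ φ′} v∈ (still-free c v w r λ e →
          true≢false (proj₁ (proj₂ (free-elim {c} {S} {φ st} r))) (subst (λ z → avail c z ≡ false) (sym e) p))))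
    dem″ : ∀ s → S′ s ≡ true → remaining T S′ s ≤ d′ (φ′ s)
    dem″ s s∈ with ◂-elim {X = S} s∈
    ... | inj₁ a    = subst (λ v → remaining T S′ s ≤ d′ v) (sym (old a)) (dem′ s a)
    ... | inj₂ refl = subst (λ v → remaining T S′ s ≤ d′ v) (sym new) (≤-trans rem≤E (fresh′ y y∉B y∉im))

  remaining-mono : ∀ {S} t s → remaining T (S ◂ t) s ≤ remaining T S s
  remaining-mono {S} t s = #-mono λ u p → let (a , b) = ∧-elim {not ((S ◂ t) u)} p in
    ∧-intro (not-intro (≡false λ q → true≢false (◂-old {X = S} q) (not-elim a))) b

  remaining-child : ∀ {S p t} → S t ≡ false → adj T p t ≡ true → suc (remaining T (S ◂ t) p) ≤ remaining T S p
  remaining-child {S} {p} {t} t∉S pt = ≤-trans (≤-reflexive (sym (#-◂ {X = R′} (≡false λ q →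
      true≢false (◂-new {X = S}) (not-elim (proj₁ (∧-elim {not ((S ◂ t) t)} q))))))) (#-mono sub)
    where
    R′ : FinSet k
    R′ u = not ((S ◂ t) u) ∧ adj T p u
    sub : ∀ u → (R′ ◂ t) u ≡ true → not (S u) ∧ adj T p u ≡ true
    sub u q with ◂-elim {X = R′} q
    ... | inj₂ refl = ∧-intro (not-intro t∉S) pt
    ... | inj₁ r = let (a , b) = ∧-elim {not ((S ◂ t) u)} r in
      ∧-intro (not-intro (≡false λ z → true≢false (◂-old {X = S} z) (not-elim a))) b

  place-child : ∀ {S} (st : State S) t p → 1 ≤ m → S t ≡ false → S p ≡ true → adj T p t ≡ true →
    (∀ s → S s ≡ true → adj T s t ≡ true → s ≡ p) → Large st (colour t) → remaining T (S ◂ t) t ≤ E →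
    State (S ◂ t)
  place-child {S} st t p 1≤m t∉S p∈S pt uniq large rem≤E =
    place st t (φ st p) 1≤m t∉S (≤-trans (s≤s z≤n) supply) large
      (λ s a e → cong (φ st) (uniq s a e)) dem′ fresh′ rem≤E
    where
    supply : suc (remaining T (S ◂ t) p) ≤ d st (φ st p)
    supply = ≤-trans (remaining-child {S} t∉S pt) (dem st p p∈S)
    dem′ : ∀ s → S s ≡ true → remaining T (S ◂ t) s ≤ lower (d st) (φ st p) (φ st s)
    dem′ s s∈S with s ≟ᶠ p
    ... | yes refl = subst (remaining T (S ◂ t) s ≤_) (sym (lower-self (d st) (φ st s))) (∸-monoˡ-≤ 1 supply)
    ... | no s≢p = subst (remaining T (S ◂ t) s ≤_) (sym (lower-other (d st) λ e → s≢p (inj st s p s∈S p∈S e)))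
      (≤-trans (remaining-mono {S} t s) (dem st s s∈S))
    fresh′ : ∀ v → B v ≡ false → image S (φ st) v ≡ false → E ≤ lower (d st) (φ st p) v
    fresh′ v b i = subst (E ≤_) (sym (lower-other (d st) v≢)) (fresh st v b i)
      where
      v≢ : v ≢ φ st p
      v≢ e = true≢false (subst (λ z → image S (φ st) z ≡ true) (sym e) (image-intro {S = S} {φ st} p∈S)) i

-- Embedding the leaves

module Completion {n k m₁ m₂ : ℕ} (H : Graph n) (T : Graph k) (connected : Connected T) (3≤leaves : 3 ≤ # (leaf T))
  (k+m₁ : k + m₁ ≡ suc n) (1≤n : 1 ≤ n) (ex₂ : WeakExpander H m₂ m₂)
  (W : FinSet n) (W-sparse : ∀ X → # X ≡ m₁ → # (W ∩ nonneighbours H X) < m₂)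
  (S : FinSet k) (S⊆inner : S ⊆ inner T) (inner⊆S : inner T ⊆ S)
  (φ : Fin k → Fin n) (inj : ∀ s t → S s ≡ true → S t ≡ true → φ s ≡ φ t → s ≡ t)
  (hom : ∀ s t → S s ≡ true → S t ≡ true → adj T s t ≡ true → adj H (φ s) (φ t) ≡ true)
  (d : Fin n → ℕ) (dem : ∀ t → S t ≡ true → remaining T S t ≤ d (φ t))
  (small-hall : ∀ Z → # Z ≤ 2 * m₂ → weight d Z ≤ # (Γ (λ x y → adj H x y ∧ not (image S φ y)) Z))
  (P : FinSet k) (P⊆parent : P ⊆ Tree.parent T connected 3≤leaves) (#P : # P ≡ 2 * m₂)
  (P-in-W : ∀ t → P t ≡ true → W (φ t) ≡ true) where

  open ≤-Reasoning
  open Tree T connected 3≤leaves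

  L = # (leaf T)

  rem : Fin k → ℕ
  rem = remaining T S

  leaf-of-missing : ∀ {u} → S u ≡ false → leaf T u ≡ true
  leaf-of-missing {u} u∉S with bool (leaf T u)
  ... | inj₁ p = p
  ... | inj₂ p = true≢false (inner⊆S u (not-intro p)) u∉S

  P⊆S : P ⊆ S
  P⊆S t p = inner⊆S t (proj₁ (∧-elim {inner T t} (P⊆parent t p)))

  1≤rem : ∀ t → P t ≡ true → 1 ≤ rem t
  1≤rem t p =
    let (l , q) = some-elim _ (proj₂ (∧-elim {inner T t} (P⊆parent t p)))
        (l-leaf , tl) = ∧-elim {leaf T l} q in
    #-mem _ l (∧-intro (not-intro (≡false λ l∈S → true≢false l-leaf (not-elim (S⊆inner l l∈S)))) tl)

  weight-rem≤ : ∀ A → weight rem A ≤ L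
  weight-rem≤ A = begin
    weight rem A                                 ≡⟨ weight-sum rem A ⟩
    sum (λ t → weigh (A t) (rem t))          ≤⟨ sum-mono (λ t → ≤-trans (weigh≤ (A t) (rem t)) (#-mono (to-leaf t))) ⟩
    sum (λ t → # (λ u → leaf T u ∧ adj T t u))   ≡⟨ double-count (λ t u → leaf T u ∧ adj T t u) ⟩
    sum (λ u → # (λ t → leaf T u ∧ adj T t u))   ≤⟨ sum≤# (leaf T) one ⟩
    L                                            ∎
    where
    to-leaf : ∀ t → (λ u → not (S u) ∧ adj T t u) ⊆ (λ u → leaf T u ∧ adj T t u)
    to-leaf t u p = let (a , b) = ∧-elim {not (S u)} p in ∧-intro (leaf-of-missing (not-elim a)) b
    one : ∀ u → # (λ t → leaf T u ∧ adj T t u) ≤ weigh (leaf T u) 1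
    one u with bool (leaf T u)
    ... | inj₂ q rewrite q = ≤-reflexive (weight-∅ _ λ _ ())
    ... | inj₁ q rewrite q = #-unique _ λ s t a b → leaf-unique T q (trans (adj-sym T u s) a) (trans (adj-sym T u t) b)

  fibre : Fin n → FinSet k
  fibre v t = S t ∧ (φ t == v)

  demand : Fin n → ℕ
  demand v = weight rem (fibre v)

  demand≤d : ∀ v → demand v ≤ d v
  demand≤d v with bool (some (fibre v))
  ... | inj₂ q = ≤-trans (≤-reflexive (weight-∅ rem (none q))) z≤n
  ... | inj₁ q = let (t , p) = some-elim _ q ; (t∈S , e) = ∧-elim {S t} p in begin
    weight rem (fibre v)  ≤⟨ weight-mono {Y = _== t} (λ s r → let (s∈S , e′) = ∧-elim {S s} r in
                               ==-intro (inj s t s∈S t∈S (trans (==-elim e′) (sym (==-elim e))))) (λ _ _ → ≤-refl) ⟩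
    weight rem (_== t)    ≡⟨ weight-single rem t ⟩
    rem t                 ≤⟨ dem t t∈S ⟩
    d (φ t)               ≡⟨ cong d (==-elim e) ⟩
    d v                   ∎

  rem≤demand : ∀ t → S t ≡ true → rem t ≤ demand (φ t)
  rem≤demand t t∈S = begin
    rem t                    ≡⟨ weight-single rem t ⟨
    weight rem (_== t)       ≤⟨ weight-mono {Y = fibre (φ t)} single⊆ (λ _ _ → ≤-refl) ⟩
    weight rem (fibre (φ t)) ∎
    where
    single⊆ : (_== t) ⊆ fibre (φ t)
    single⊆ s e = ∧-intro (subst (λ z → S z ≡ true) (sym (==-elim e)) t∈S) (==-intro (cong φ (==-elim e)))

  preimage : FinSet n → FinSet k
  preimage Z t = S t ∧ Z (φ t)

  weight-demand≤ : ∀ Z → weight demand Z ≤ weight rem (preimage Z)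
  weight-demand≤ Z = begin
    weight demand Z                                              ≡⟨ weight-sum demand Z ⟩
    sum (λ v → weigh (Z v) (weight rem (fibre v)))               ≡⟨ sum-cong nest-sum ⟩
    sum (λ v → sum (λ t → weigh (Z v ∧ fibre v t) (rem t)))      ≡⟨ sum-swap (λ v t → weigh (Z v ∧ fibre v t) (rem t)) ⟩
    sum (λ t → sum (λ v → weigh (Z v ∧ fibre v t) (rem t)))      ≤⟨ sum-mono single ⟩
    sum (λ t → weigh (preimage Z t) (rem t))                     ≡⟨ weight-sum rem (preimage Z) ⟨
    weight rem (preimage Z)                                      ∎
    where
    nest : ∀ b (X : FinSet k) → weigh b (weight rem X) ≡ weight rem (λ t → b ∧ X t)
    nest true  X = refl
    nest false X = sym (weight-∅ rem λ _ ())
    nest-sum : ∀ v → weigh (Z v) (weight rem (fibre v)) ≡ sum (λ t → weigh (Z v ∧ fibre v t) (rem t))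
    nest-sum v = trans (nest (Z v) (fibre v)) (weight-sum rem (λ t → Z v ∧ fibre v t))
    single : ∀ t → sum (λ v → weigh (Z v ∧ fibre v t) (rem t)) ≤ weigh (preimage Z t) (rem t)
    single t = begin
      sum (λ v → weigh (Z v ∧ fibre v t) (rem t))      ≡⟨ weight-sum (λ _ → rem t) (λ v → Z v ∧ fibre v t) ⟨
      weight (λ _ → rem t) (λ v → Z v ∧ fibre v t)     ≤⟨ bound ⟩
      weigh (preimage Z t) (rem t)                     ∎
      where
      bound : weight (λ _ → rem t) (λ v → Z v ∧ fibre v t) ≤ weigh (preimage Z t) (rem t)
      bound with bool (preimage Z t)
      ... | inj₁ q = subst (weight (λ _ → rem t) (λ v → Z v ∧ fibre v t) ≤_)
        (trans (weight-single (λ _ → rem t) (φ t)) (cong (λ b → weigh b (rem t)) (sym q)))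
        (weight-mono {Y = _== φ t} (λ v p → ==-intro (sym (==-elim (proj₂ (∧-elim {S t} (proj₂ (∧-elim {Z v} p)))))))
          (λ _ _ → ≤-refl))
      ... | inj₂ q = ≤-trans (≤-reflexive (weight-∅ _ λ v p →
        let (z , f) = ∧-elim {Z v} p ; (s , e) = ∧-elim {S t} f in
        true≢false (∧-intro s (subst (λ y → Z y ≡ true) (sym (==-elim e)) z)) q)) z≤n

  N : FinSet n → FinSet n
  N = Γ (λ x y → adj H x y ∧ not (image S φ y))

  isolated : FinSet n → FinSet n
  isolated Z y = not (image S φ y) ∧ not (Γ (adj H) Z y)

  isolated-elim : ∀ {Z y} → isolated Z y ≡ true →
    image S φ y ≡ false × (∀ z → Z z ≡ true → adj H z y ≡ true → ⊥)
  isolated-elim {Z} {y} p = let (a , b) = ∧-elim {not (image S φ y)} p in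
    not-elim a , λ z z∈ e → true≢false (Γ-intro {R = adj H} z∈ e) (not-elim b)

  -- L + m₁ exceeds by one the number of vertices outside the image of S.
  supply : ∀ Z → L + m₁ ≤ suc (# (N Z) + # (isolated Z))
  supply Z = linear 0 (≤-reflexive (sym #-full) ⊕ #-cover {Y = image S φ} {N Z ∪ isolated Z} split
      ⊕ weight-∪ _ (N Z) (isolated Z)
      ⊕ #-image≤ (inner T) (image S φ) φ (λ y p →
          let (t , a , e) = image-elim {S = S} {φ} p in t , S⊆inner t a , e)
      ⊕ ≤-reflexive (#-∁ (leaf T)) ⊕ ≤-reflexive k+m₁)
    (eq n k m₁ L (# (inner T)) (# (full {n})) (# (image S φ)) (# (N Z ∪ isolated Z)) (# (N Z)) (# (isolated Z)))
    where
    split : ∀ v → full {n} v ≡ true → image S φ v ≡ true ⊎ (N Z ∪ isolated Z) v ≡ true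
    split v _ with bool (image S φ v) | bool (Γ (adj H) Z v)
    ... | inj₁ i | _      = inj₁ i
    ... | inj₂ i | inj₂ q = inj₂ (∨-introʳ {N Z v} (∧-intro (not-intro i) (not-intro q)))
    ... | inj₂ i | inj₁ q = let (z , z∈ , e) = Γ-elim {R = adj H} {Z} q in
      inj₂ (∨-introˡ (Γ-intro {R = λ x y → adj H x y ∧ not (image S φ y)} z∈ (∧-intro e (not-intro i))))
    eq : ∀ n k a L j f i u g x →
      suc (g + x) + (n + (f + (u + (i + (L + j + (k + a))))))
      ≡ L + a + (f + (i + u + (g + x + (j + (k + suc n))))) + 0
    eq = solve-∀

  -- With at least m₁ isolated vertices, sparsity of W keeps most of φ(P) outside Z, which saves m₂ of the demand;
  -- on the other hand Z is large, so fewer than m₂ vertices are isolated.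
  large-hall : ∀ Z → 2 * m₂ < # Z → weight demand Z ≤ # (N Z)
  large-hall Z large with # (isolated Z) <? m₁
  ... | yes few = linear 0 (weight-demand≤ Z ⊕ weight-rem≤ (preimage Z) ⊕ supply Z ⊕ few)
      (eq (weight demand Z) (weight rem (preimage Z)) L m₁ (# (N Z)) (# (isolated Z)))
    where
    eq : ∀ w p L a g x → g + (w + (p + (L + a + suc x))) ≡ w + (p + (L + (suc (g + x) + a))) + 0
    eq = solve-∀
  ... | no many = linear m₁ (weight-demand≤ Z ⊕ saved ⊕ supply Z ⊕ few)
      (eq (weight demand Z) (weight rem (preimage Z)) L m₁ m₂ (# (N Z)) (# (isolated Z)))
    where
    eq : ∀ w p L a b g x → g + (w + (p + b + (L + a + suc x))) ≡ w + (p + (L + (suc (g + x) + b))) + a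
    eq = solve-∀
    few : # (isolated Z) < m₂
    few = ≰⇒> λ le → let (Y , Y⊆ , size) = subset-of-size m₂ (isolated Z) le in <⇒≱ large (begin
      # Z                                  ≤⟨ #-cover {Y = nonneighbours H Y} {Y} (split Y Y⊆) ⟩
      # (nonneighbours H Y) + # Y          ≤⟨ +-mono-≤ (<⇒≤ (expander-nonneighbours H ex₂ Y size)) (≤-reflexive size) ⟩
      m₂ + m₂                              ≡⟨ cong (m₂ +_) (+-identityʳ m₂) ⟨
      2 * m₂                               ∎)
      where
      split : ∀ Y → Y ⊆ isolated Z → ∀ v → Z v ≡ true → nonneighbours H Y v ≡ true ⊎ Y v ≡ true
      split Y Y⊆ v z with bool (Y v)
      ... | inj₁ q = inj₂ q
      ... | inj₂ q = inj₁ (nonneighbours-intro H (λ p → true≢false p q) λ y y∈ e →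
        proj₂ (isolated-elim (Y⊆ y y∈)) v z (trans (adj-sym H v y) e))
    hit : # (P ∩ preimage Z) < m₂
    hit = let (Y , Y⊆ , size) = subset-of-size m₁ (isolated Z) (≮⇒≥ many) in
      ≤-<-trans (#-injective≤ (P ∩ preimage Z) (W ∩ nonneighbours H Y) φ (into Y Y⊆)
        λ s t a b e → inj s t (P⊆S s (proj₁ (∧-elim {P s} a))) (P⊆S t (proj₁ (∧-elim {P t} b))) e)
        (W-sparse Y size)
      where
      into : ∀ Y → Y ⊆ isolated Z → ∀ t → (P ∩ preimage Z) t ≡ true → (W ∩ nonneighbours H Y) (φ t) ≡ true
      into Y Y⊆ t p = let (t∈P , q) = ∧-elim {P t} p ; (t∈S , z) = ∧-elim {S t} q in
        ∧-intro (P-in-W t t∈P) (nonneighbours-intro H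
          (λ y → true≢false (image-intro {S = S} {φ} t∈S) (proj₁ (isolated-elim {Z} (Y⊆ (φ t) y))))
          λ y y∈ e → proj₂ (isolated-elim (Y⊆ y y∈)) (φ t) z (trans (adj-sym H (φ t) y) e))
    missed-P = P ∖ preimage Z
    saved : weight rem (preimage Z) + m₂ ≤ L
    saved = linear 1 (≤-reflexive (sym #P) ⊕ P-split ⊕ hit
        ⊕ *≤weight 1 missed-P (λ t p → 1≤rem t (proj₁ (∧-elim {P t} p)))
        ⊕ ≤-reflexive (sym (weight-disjoint rem (preimage Z) missed-P λ t a b →
            true≢false a (not-elim (proj₂ (∧-elim {P t} b)))))
        ⊕ weight-rem≤ (preimage Z ∪ missed-P))
      (eq₂ m₂ (# P) (# (P ∩ preimage Z)) (# missed-P) (weight rem (preimage Z)) (weight rem missed-P)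
        (weight rem (preimage Z ∪ missed-P)) L)
      where
      P-split : # P ≤ # (P ∩ preimage Z) + # missed-P
      P-split = #-cover {Y = P ∩ preimage Z} {missed-P} λ t p → case t p (bool (preimage Z t))
        where
        case : ∀ t → P t ≡ true → preimage Z t ≡ true ⊎ preimage Z t ≡ false →
          (P ∩ preimage Z) t ≡ true ⊎ missed-P t ≡ true
        case t p (inj₁ q) = inj₁ (∧-intro p q)
        case t p (inj₂ q) = inj₂ (∧-intro p (not-intro q))
      eq₂ : ∀ b p h e w v u L → L + (2 * b + (p + (suc h + (1 * e + (w + v + u)))))
        ≡ w + b + (p + (h + e + (b + (v + (u + L))))) + 1
      eq₂ = solve-∀

  hall : ∀ Z → weight demand Z ≤ # (N Z)
  hall Z with # Z ≤? 2 * m₂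
  ... | yes le = ≤-trans (weight-mono {Y = Z} (λ _ p → p) λ v _ → demand≤d v) (small-hall Z le)
  ... | no ¬le = large-hall Z (≰⇒> ¬le)

  open Embedding H T {⊤} (λ _ → full) (λ _ _ _ → refl) (λ _ → tt) ∅ n 0 demand
  open State using () renaming (φ to embed; inj to embed-inj; hom to embed-hom)

  state-inner : State S
  state-inner = record
    { φ     = φ
    ; d     = demand
    ; inj   = inj
    ; hom   = hom
    ; cls   = λ _ _ → refl
    ; hall  = λ _ Z _ → hall Z
    ; dem   = rem≤demand
    ; fresh = λ _ _ _ → z≤n
    ; bound = λ _ → ≤-refl }

  embed-leaves : ∀ fuel {S′} → State S′ → inner T ⊆ S′ → k ≤ fuel + # S′ → Contains H T
  embed-leaves fuel {S′} st inner⊆S′ le with bool (some (∁ S′))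
  ... | inj₂ done = embed st , (λ {s} {t} → embed-inj st s t (all s) (all t)) , λ s t → embed-hom st s t (all s) (all t)
    where
    all : ∀ t → S′ t ≡ true
    all t with bool (S′ t)
    ... | inj₁ p = p
    ... | inj₂ p = ⊥-elim (none done t (not-intro p))
  embed-leaves zero {S′} st inner⊆S′ le | inj₁ more =
    ⊥-elim (<⇒≱ (≤-trans (≤-reflexive (sym (#-◂ {X = S′} (not-elim (proj₂ (some-elim _ more)))))) (#≤n (S′ ◂ _))) le)
  embed-leaves (suc fuel) {S′} st inner⊆S′ le | inj₁ more =
    embed-leaves fuel (place-child st t p 1≤n t∉S′ p∈S′ pt
        (λ s _ st′ → leaf-unique T t-leaf (trans (adj-sym T t s) st′) tp)
        (λ X lt _ → ⊥-elim (<⇒≱ lt (#≤n X)))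
        (≤-reflexive (weight-∅ _ λ u q → let (a , b) = ∧-elim {not ((S′ ◂ t) u)} q in
          true≢false (◂-old {X = S′} (inner⊆S′ u (leaf-neighbour-inner t-leaf b))) (not-elim a))))
      (λ i q → ◂-old {X = S′} (inner⊆S′ i q))
      (subst (k ≤_) (trans (sym (+-suc fuel (# S′))) (cong (fuel +_) (sym (#-◂ {X = S′} t∉S′)))) le)
    where
    t = proj₁ (some-elim _ more)
    t∉S′ : S′ t ≡ false
    t∉S′ = not-elim (proj₂ (some-elim _ more))
    t-leaf : leaf T t ≡ true
    t-leaf with bool (leaf T t)
    ... | inj₁ q = q
    ... | inj₂ q = true≢false (inner⊆S′ t (not-intro q)) t∉S′
    p = proj₁ (leaf-neighbour T t-leaf)
    tp = proj₂ (leaf-neighbour T t-leaf)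
    pt = trans (adj-sym T p t) tp
    p∈S′ = inner⊆S′ p (leaf-neighbour-inner t-leaf tp)

  contains : Contains H T
  contains = embed-leaves k state-inner inner⊆S (m≤m+n k _)

-- Embedding the inner vertices

nonneighbours-cong : ∀ {n} (H : Graph n) {X Y} → X ≗ Y → nonneighbours H X ≗ nonneighbours H Y
nonneighbours-cong H X≗Y y = cong₂ (λ a b → not a ∧ not b) (X≗Y y) (Γ-cong {R = adj H} X≗Y y)

sparse-set : ∀ {n m₁ m₂ D} (H : Graph n) → 1 ≤ D → 1 ≤ m₂ → 24 * D * m₂ ≤ n → n ^ (6 * m₁) < 4 ^ m₂ →
  WeakExpander H m₁ (ceilDiv n (32 * D ∸ 1)) →
  ∃ λ W → # W ≡ 6 * D * m₂ × (∀ X → # X ≡ m₁ → # (W ∩ nonneighbours H X) < m₂)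
sparse-set {n} {m₁} {m₂} {D@(suc _)} H 1≤D 1≤m₂ large few expander = W , W-size , sparse
  where
  family = filter (λ X → # X ≟ m₁) (tuples {n} m₁)
  short : length (map (nonneighbours H) family) ^ 6 < 4 ^ m₂
  short = ≤-<-trans (^-monoˡ-≤ 6 (≤-trans (≤-reflexive (length-map (nonneighbours H) family))
      (≤-trans (length-filter (λ X → # X ≟ m₁) (tuples m₁)) (≤-reflexive (length-tuples m₁)))))
    (subst (_< 4 ^ m₂) (trans (cong (n ^_) (*-comm 6 m₁)) (sym (^-*-assoc n m₁ 6))) few)
  selected = sparse-on-family {D = D} (map (nonneighbours H) family) 1≤D 1≤m₂ large
    (All.map⁺ (All.map (λ {X} size → <ceilDiv⇒ n (32 * D ∸ 1) (expander-nonneighbours H expander X size))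
      (All.all-filter (λ X → # X ≟ m₁) (tuples m₁)))) short
  W = proj₁ selected
  W-size = proj₁ (proj₂ selected)
  sparse : ∀ X → # X ≡ m₁ → # (W ∩ nonneighbours H X) < m₂
  sparse X size = let (Y , Y∈ , X≗Y) = tuples-complete m₁ X size in
    subst (_< m₂) (weight-cong _ λ i → cong (W i ∧_) (sym (nonneighbours-cong H X≗Y i)))
      (All.lookup (proj₂ (proj₂ selected)) (∈-map⁺ (nonneighbours H)
        (∈-filter⁺ (λ X → # X ≟ m₁) Y∈ (trans (sym (weight-cong _ X≗Y)) size))))

module _ {n} (H : Graph n) where

  to : FinSet n → Fin n → Fin n → Bool
  to V x y = adj H x y ∧ V y

  missed : FinSet n → FinSet n → FinSet n
  missed V X = V ∖ Γ (adj H) X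

  #≤reached+missed : ∀ V X → # V ≤ # (Γ (to V) X) + # (missed V X)
  #≤reached+missed V X = #-cover {Y = Γ (to V) X} {missed V X} split
    where
    split : ∀ i → V i ≡ true → Γ (to V) X i ≡ true ⊎ missed V X i ≡ true
    split i p with bool (Γ (adj H) X i)
    ... | inj₂ q = inj₂ (∧-intro p (not-intro q))
    ... | inj₁ q = let (x , a , e) = Γ-elim {R = adj H} {X} q in inj₁ (Γ-intro {R = to V} a (∧-intro e p))

  #missed≤ : ∀ V {X Y} → Y ⊆ X → # (missed V X) ≤ # (V ∩ nonneighbours H Y) + # Y
  #missed≤ V {X} {Y} s = #-cover {Y = V ∩ nonneighbours H Y} {Y} split
    where
    split : ∀ i → missed V X i ≡ true → (V ∩ nonneighbours H Y) i ≡ true ⊎ Y i ≡ true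
    split i p with bool (Y i)
    ... | inj₁ q = inj₂ q
    ... | inj₂ q = let (a , b) = ∧-elim {V i} p in
      inj₁ (∧-intro a (nonneighbours-intro H (λ r → true≢false r q) λ x r e →
        true≢false (Γ-intro {R = adj H} (s x r) e) (not-elim b)))

module Proof {n k m₁ m₂ D : ℕ} (1≤m₁ : 1 ≤ m₁) (6m₁≤m₂ : 6 * m₁ ≤ m₂) (k+m₁ : k + m₁ ≡ suc n)
  (H : Graph n) (ex₁ : WeakExpander H m₁ (ceilDiv n (32 * D ∸ 1))) (ex₂ : WeakExpander H m₂ m₂)
  (few : n ^ (6 * m₁) < 4 ^ m₂)
  (T : Graph k) (connected : Connected T) (acyclic : Acyclic T) (maxdeg : MaxDegreeAtMost T D)
  (1≤D : 1 ≤ D) (many-leaves : 24 * D * m₂ ≤ leaves T) where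

  open ≤-Reasoning

  m₁≤m₂ : m₁ ≤ m₂
  m₁≤m₂ = linear (5 * m₁) 6m₁≤m₂ (eq m₁ m₂)
    where
    eq : ∀ a b → b + 6 * a ≡ a + b + 5 * a
    eq = solve-∀

  6≤m₂ : 6 ≤ m₂
  6≤m₂ = ≤-trans (*-monoʳ-≤ 6 1≤m₁) 6m₁≤m₂

  m₂≤Dm₂ : m₂ ≤ D * m₂
  m₂≤Dm₂ = ≤-trans (≤-reflexive (sym (*-identityˡ m₂))) (*-monoˡ-≤ m₂ 1≤D)

  L = # (leaf T)

  24Dm₂≤L : 24 * D * m₂ ≤ L
  24Dm₂≤L = subst (24 * D * m₂ ≤_) (leaves≡ T) many-leaves

  24m₂≤24Dm₂ : 24 * m₂ ≤ 24 * D * m₂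
  24m₂≤24Dm₂ = subst (24 * m₂ ≤_) (sym (*-assoc 24 D m₂)) (*-monoʳ-≤ 24 m₂≤Dm₂)

  opaque
    3≤L : 3 ≤ L
    3≤L = ≤-trans (≤-trans (≤ᵇ⇒≤ 3 (24 * 6) tt) (*-monoʳ-≤ 24 6≤m₂)) (≤-trans 24m₂≤24Dm₂ 24Dm₂≤L)

  open Tree T connected 3≤L

  2≤D : 2 ≤ D
  2≤D = let (r , _ , le) = inner-with-neighbour in ≤-trans le (subst (_≤ D) (degree≡ T r) (maxdeg r))

  2m₂≤Dm₂ : 2 * m₂ ≤ D * m₂
  2m₂≤Dm₂ = *-monoˡ-≤ m₂ 2≤D

  L+inner : L + # (inner T) ≡ k
  L+inner = #-∁ (leaf T)

  24Dm₂≤n : 24 * D * m₂ ≤ n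
  24Dm₂≤n = linear (# (inner T)) (24Dm₂≤L ⊕ ≤-reflexive L+inner ⊕ ≤-reflexive k+m₁ ⊕ 1≤m₁)
    (eq (24 * D * m₂) n L (# (inner T)) k m₁)
    where
    eq : ∀ a n L i k m → n + (a + (L + i + (k + m + 1))) ≡ a + (L + (k + (suc n + m))) + i
    eq = solve-∀

  opaque
    sparse : ∃ λ W → # W ≡ 6 * D * m₂ × (∀ X → # X ≡ m₁ → # (W ∩ nonneighbours H X) < m₂)
    sparse = sparse-set H 1≤D (≤-trans (s≤s z≤n) 6≤m₂) 24Dm₂≤n few ex₁

  W = proj₁ sparse
  #W : # W ≡ 6 * D * m₂
  #W = proj₁ (proj₂ sparse)
  W-sparse = proj₂ (proj₂ sparse)

  avail : Bool → FinSet n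
  avail true  = W
  avail false = ∁ W

  avail-disjoint : ∀ {c c′} v → avail c v ≡ true → avail c′ v ≡ true → c ≡ c′
  avail-disjoint {true}  {true}  v p q = refl
  avail-disjoint {true}  {false} v p q = true≢false p (not-elim q)
  avail-disjoint {false} {true}  v p q = true≢false q (not-elim p)
  avail-disjoint {false} {false} v p q = refl

  #∁W : 6 * D * m₂ + # (∁ W) ≡ n
  #∁W = trans (cong (_+ # (∁ W)) (sym #W)) (#-∁ W)

  missed-large : ∀ c X → m₂ ≤ # X → # (missed H (avail c) X) ≤ 2 * m₂
  missed-large true X le =
    let (Y , Y⊆X , size) = subset-of-size m₁ X (≤-trans m₁≤m₂ le) in
    linear 0 (#missed≤ H W Y⊆X ⊕ <⇒≤ (W-sparse Y size) ⊕ ≤-reflexive size ⊕ m₁≤m₂)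
      (eq (# (missed H W X)) (# (W ∩ nonneighbours H Y)) (# Y) m₁ m₂)
    where
    eq : ∀ g w y a b → 2 * b + (g + (w + (y + a))) ≡ g + (w + y + (b + (a + b))) + 0
    eq = solve-∀
  missed-large false X le =
    let (Y , Y⊆X , size) = subset-of-size m₂ X le
        V = ∁ W ∩ nonneighbours H Y
        V≤ = #-mono {X = V} {nonneighbours H Y} (λ i p → proj₂ (∧-elim {∁ W i} p)) in
    linear 0 (#missed≤ H (∁ W) Y⊆X ⊕ ≤-trans V≤ (<⇒≤ (expander-nonneighbours H ex₂ Y size)) ⊕ ≤-reflexive size)
      (eq (# (missed H (∁ W) X)) (# V) (# Y) m₂)
    where
    eq : ∀ g w y b → 2 * b + (g + (w + y)) ≡ g + (w + y + (b + b)) + 0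
    eq = solve-∀

  expand : ∀ c X → m₁ ≤ # X → # X ≤ 2 * m₂ → suc D * (2 * m₂) + 2 * m₁ ≤ # (Γ (to H (avail c)) X)
  expand true X le _ =
    let (Y , Y⊆X , size) = subset-of-size m₁ X le in
    *-cancelˡ-≤ 2 (linear (4 * (D * m₂) + m₂)
      (*-monoʳ-≤ 2 (≤-reflexive (sym #W) ⊕ #≤reached+missed H W X ⊕ #missed≤ H W Y⊆X
          ⊕ <⇒≤ (W-sparse Y size) ⊕ ≤-reflexive size)
        ⊕ 6m₁≤m₂ ⊕ *-monoʳ-≤ 4 2m₂≤Dm₂)
      (eq (# W) (# (Γ (to H W) X)) (# (missed H W X)) (# (W ∩ nonneighbours H Y)) (# Y) m₁ m₂ D))
    where
    eq : ∀ w r g v y a b D → 2 * r + (2 * (6 * D * b + (w + (g + (v + y)))) + (6 * a + 4 * (2 * b)))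
       ≡ 2 * (suc D * (2 * b) + 2 * a) + (2 * (w + (r + g + (v + y + (b + a)))) + (b + 4 * (D * b))) + (4 * (D * b) + b)
    eq = solve-∀
  expand false X le _ =
    let (Y , Y⊆X , size) = subset-of-size m₁ X le
        V = ∁ W ∩ nonneighbours H Y
        V≤ = #-mono {X = V} {nonneighbours H Y} (λ i p → proj₂ (∧-elim {∁ W i} p)) in
    *-cancelˡ-≤ 32 (linear (408 * (D * m₂))
      (*-monoʳ-≤ 32 (≤-reflexive (sym #∁W) ⊕ #≤reached+missed H (∁ W) X ⊕ #missed≤ H (∁ W) Y⊆X
          ⊕ V≤ ⊕ ≤-reflexive size)
        ⊕ few-nonneighbours Y size ⊕ *-monoʳ-≤ 31 24Dm₂≤n ⊕ *-monoʳ-≤ 16 6m₁≤m₂ ⊕ *-monoʳ-≤ 80 m₂≤Dm₂)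
      (eq n (# (∁ W)) (# (Γ (to H (∁ W)) X)) (# (missed H (∁ W) X)) (# V) (# Y) (# (nonneighbours H Y)) m₁ m₂ D))
    where
    few-nonneighbours : ∀ Y → # Y ≡ m₁ → 32 * # (nonneighbours H Y) ≤ n
    few-nonneighbours Y size = begin
      32 * # (nonneighbours H Y)                 ≤⟨ *-monoˡ-≤ (# (nonneighbours H Y)) 32≤ ⟩
      suc (32 * D ∸ 1) * # (nonneighbours H Y)   ≤⟨ <ceilDiv⇒ n (32 * D ∸ 1) (expander-nonneighbours H ex₁ Y size) ⟩
      n                                          ∎
      where
      32≤ : 32 ≤ suc (32 * D ∸ 1)
      32≤ = s≤s (∸-monoˡ-≤ 1 (*-monoʳ-≤ 32 1≤D))
    eq : ∀ n u r g v y z a b D →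
      32 * r + (32 * (n + (u + (g + (v + y)))) + (32 * z + (31 * (24 * D * b) + (16 * (6 * a) + 80 * b))))
      ≡ 32 * (suc D * (2 * b) + 2 * a) + (32 * (6 * D * b + u + (r + g + (v + y + (z + a))))
        + (n + (31 * n + (16 * b + 80 * (D * b))))) + 408 * (D * b)
    eq = solve-∀

  opaque
    bad : ∃ λ U → # U ≤ 2 * m₁ × ∀ c X → # X ≤ 2 * m₂ → suc D * # (X ∖ U) ≤ # (Γ (to H (avail c)) (X ∖ U) ∖ U)
    bad = BadSet.bad-set (λ c → to H (avail c)) (suc D) m₁ m₂ (s≤s z≤n) 1≤m₁
      (≤-trans (*-monoˡ-≤ m₁ (≤ᵇ⇒≤ 2 6 tt)) 6m₁≤m₂) expand

  B = proj₁ bad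
  #B≤ : # B ≤ 2 * m₁
  #B≤ = proj₁ (proj₂ bad)
  good = proj₂ (proj₂ bad)

  #parent : 2 * m₂ ≤ # parent
  #parent = *-cancelˡ-≤ D {{>-nonZero 1≤D}}
    (linear (22 * (D * m₂)) (24Dm₂≤L ⊕ leaves≤parents maxdeg) (eq D m₂ L (# parent)))
    where
    eq : ∀ D b L p → D * p + (24 * D * b + L) ≡ D * (2 * b) + (L + D * p) + 22 * (D * b)
    eq = solve-∀

  opaque
    chosen : ∃ λ P → P ⊆ parent × # P ≡ 2 * m₂
    chosen = subset-of-size (2 * m₂) parent #parent

  P₀ = proj₁ chosen
  P₀⊆parent : P₀ ⊆ parent
  P₀⊆parent = proj₁ (proj₂ chosen)
  #P₀ : # P₀ ≡ 2 * m₂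
  #P₀ = proj₂ (proj₂ chosen)

  open Embedding H T avail avail-disjoint P₀ B m₂ D (λ _ → suc D)
    renaming (State to State₁; Large to Large₁; free to free₁; free-intro to free₁-intro; free-elim to free₁-elim;
      place to place₁; place-child to place-child₁)
  module St₁ = Embedding.State

  1≤m₂ : 1 ≤ m₂
  1≤m₂ = ≤-trans (s≤s z≤n) 6≤m₂

  #image : ∀ {S} (st : State₁ S) → S ⊆ inner T → ∀ c → # (avail c ∩ image S (St₁.φ st)) ≤ # (inner T)
  #image {S} st S⊆inner c = #-image≤ (inner T) _ (St₁.φ st) λ y p →
    let (t , a , e) = image-elim {S = S} {St₁.φ st} (proj₂ (∧-elim {avail c y} p)) in t , S⊆inner t a , e

  #image-W : ∀ {S} (st : State₁ S) → # (W ∩ image S (St₁.φ st)) ≤ 2 * m₂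
  #image-W {S} st = subst (# (W ∩ image S (St₁.φ st)) ≤_) #P₀ (#-image≤ P₀ _ (St₁.φ st) λ y p →
    let (w , q) = ∧-elim {W y} p
        (t , a , e) = image-elim {S = S} {St₁.φ st} q in
    t , avail-disjoint {P₀ t} {true} y (subst (λ z → avail (P₀ t) z ≡ true) e (St₁.cls st t a)) w , e)

  #avail≤ : ∀ {S} (st : State₁ S) c X →
    # (avail c) ≤ # (Γ (free₁ c S (St₁.φ st)) X) + # (missed H (avail c) X) + (# B + # (avail c ∩ image S (St₁.φ st)))
  #avail≤ {S} st c X = ≤-trans (#-cover {Y = Γ F X ∪ missed H (avail c) X} {B ∪ I} split)
    (+-mono-≤ (weight-∪ _ (Γ F X) (missed H (avail c) X)) (weight-∪ _ B I))
    where
    F = free₁ c S (St₁.φ st)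
    I = avail c ∩ image S (St₁.φ st)
    split : ∀ v → avail c v ≡ true → (Γ F X ∪ missed H (avail c) X) v ≡ true ⊎ (B ∪ I) v ≡ true
    split v p with bool (B v) | bool (image S (St₁.φ st) v) | bool (Γ (adj H) X v)
    ... | inj₁ b | _      | _      = inj₂ (∨-introˡ b)
    ... | _      | inj₁ i | _      = inj₂ (∨-introʳ {B v} (∧-intro p i))
    ... | _      | _      | inj₂ q = inj₁ (∨-introʳ {Γ F X v} (∧-intro p (not-intro q)))
    ... | inj₂ b | inj₂ i | inj₁ q = let (x , a , e) = Γ-elim {R = adj H} {X} q in
      inj₁ (∨-introˡ (Γ-intro {R = F} a (free₁-intro {c} {S} {St₁.φ st} e p b i)))

  large₁ : ∀ {S} (st : State₁ S) → S ⊆ inner T → ∀ c → Large₁ st c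
  large₁ {S} st S⊆inner true X lt le = *-cancelˡ-≤ 3 (linear (4 * m₂ + 3)
    (*-monoʳ-≤ 3 (weight≤* (suc D) X (St₁.bound st) ⊕ *-monoʳ-≤ (suc D) le ⊕ ≤-reflexive (sym #W) ⊕ #avail≤ st true X
        ⊕ missed-large true X (<⇒≤ lt) ⊕ #B≤ ⊕ #image-W st)
      ⊕ 6m₁≤m₂ ⊕ *-monoʳ-≤ 12 2m₂≤Dm₂ ⊕ 6≤m₂)
    (eq D m₁ m₂ (weight (St₁.d st) X) (# X) (# W) (# (missed H W X)) (# B) (# (W ∩ image S (St₁.φ st)))
      (# (Γ (free₁ true S (St₁.φ st)) X))))
    where
    eq : ∀ D a b t x w ms B i g →
      3 * g + (3 * (t + (suc D * x + (6 * D * b + (w + (ms + (B + i)))))) + (6 * a + (12 * (2 * b) + 6)))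
      ≡ 3 * suc t + (3 * (suc D * x + (suc D * (2 * b) + (w + (g + ms + (B + i) + (2 * b + (2 * a + 2 * b))))))
        + (b + (12 * (D * b) + b))) + (4 * b + 3)
    eq = solve-∀
  large₁ {S} st S⊆inner false X lt le = linear (10 * m₂ + 4)
    (weight≤* (suc D) X (St₁.bound st) ⊕ *-monoʳ-≤ (suc D) le ⊕ ≤-reflexive (sym #∁W) ⊕ #avail≤ st false X
        ⊕ missed-large false X (<⇒≤ lt) ⊕ #B≤ ⊕ #image st S⊆inner false ⊕ ≤-reflexive L+inner ⊕ ≤-reflexive k+m₁
        ⊕ 24Dm₂≤L ⊕ m₁≤m₂ ⊕ *-monoʳ-≤ 16 m₂≤Dm₂ ⊕ 6≤m₂)
    (eq D m₁ m₂ (weight (St₁.d st) X) (# X) n (# (∁ W)) (# (missed H (∁ W) X)) (# B) (# (∁ W ∩ image S (St₁.φ st)))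
      (# (Γ (free₁ false S (St₁.φ st)) X)) L (# (inner T)) k)
    where
    eq : ∀ D a b t x n u ms B i g L j k →
      g + (t + (suc D * x + (n + (u + (ms + (B + (i + (L + j + (k + a + (24 * D * b + (a + (16 * b + 6))))))))))))
      ≡ suc t + (suc D * x + (suc D * (2 * b) + (6 * D * b + u + (g + ms + (B + i) + (2 * b + (2 * a + (j + (k + (suc n
        + (L + (b + (16 * (D * b) + b))))))))))) ) + (10 * b + 4)
    eq = solve-∀

  opaque
    outside-B : ∃ λ x → not (B x) ≡ true
    outside-B = #-pos (∁ B) (linear (16 * m₂ + 41 + 4 * m₁)
      (≤-reflexive (sym (#-∁ B)) ⊕ #B≤ ⊕ 24Dm₂≤n ⊕ 24m₂≤24Dm₂ ⊕ 6m₁≤m₂ ⊕ *-monoʳ-≤ 7 6≤m₂)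
      (eq n (# B) (# (∁ B)) m₁ m₂ (24 * D * m₂)))
      where
      eq : ∀ n B c a b x → c + (n + (B + (x + (24 * b + (6 * a + 7 * 6)))))
         ≡ 1 + (B + c + (2 * a + (n + (x + (b + 7 * b))))) + (16 * b + 41 + 4 * a)
      eq = solve-∀

  x₀ = proj₁ outside-B

  state-∅ : State₁ ∅
  state-∅ = record
    { φ     = λ _ → x₀
    ; d     = d
    ; inj   = λ _ _ ()
    ; hom   = λ _ _ ()
    ; cls   = λ _ ()
    ; hall  = hall
    ; dem   = λ _ ()
    ; fresh = λ v b _ → ≤-trans (n≤1+n D) (≤-reflexive (cong (λ z → weigh (not z) (suc D)) (sym b)))
    ; bound = λ v → weigh≤ (not (B v)) (suc D) }
    where
    d : Fin n → ℕ
    d v = weigh (not (B v)) (suc D)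
    unnest-weigh : ∀ a b s → weigh a (weigh b s) ≡ weigh (a ∧ b) s
    unnest-weigh true  b s = refl
    unnest-weigh false b s = refl
    unnest : ∀ {X} → weight d X ≡ weight (λ _ → suc D) (X ∖ B)
    unnest {X} = trans (weight-sum d X) (trans (sum-cong λ v → unnest-weigh (X v) (not (B v)) (suc D))
      (sym (weight-sum (λ _ → suc D) (X ∖ B))))
    hall : ∀ c X → # X ≤ 2 * m₂ → weight d X ≤ # (Γ (free₁ c ∅ (λ _ → x₀)) X)
    hall c X le = begin
      weight d X                            ≡⟨ unnest ⟩
      weight (λ _ → suc D) (X ∖ B)          ≤⟨ weight≤* (suc D) (X ∖ B) (λ _ → ≤-refl) ⟩
      suc D * # (X ∖ B)                     ≤⟨ good c X le ⟩
      # (Γ (to H (avail c)) (X ∖ B) ∖ B)    ≤⟨ #-mono sub ⟩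
      # (Γ (free₁ c ∅ (λ _ → x₀)) X)        ∎
      where
      sub : (Γ (to H (avail c)) (X ∖ B) ∖ B) ⊆ Γ (free₁ c ∅ (λ _ → x₀)) X
      sub y p =
        let (q , r) = ∧-elim {Γ (to H (avail c)) (X ∖ B) y} p
            (x , a , e) = Γ-elim {R = to H (avail c)} {X ∖ B} q
            (e₁ , e₂) = ∧-elim {adj H x y} e in
        Γ-intro {R = free₁ c ∅ (λ _ → x₀)} (proj₁ (∧-elim {X x} a))
          (free₁-intro {c} {∅} {λ _ → x₀} e₁ e₂ (not-elim r) (≡false λ i →
            let (_ , z , _) = image-elim {S = ∅} {λ (_ : Fin k) → x₀} {y} i in true≢false z refl))

  remaining≤D : ∀ S t → remaining T S t ≤ D
  remaining≤D S t = ≤-trans (#-mono λ u p → proj₂ (∧-elim {not (S u)} p)) (subst (_≤ D) (degree≡ T t) (maxdeg t))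

  opaque
    root : ∃ λ r → inner T r ≡ true
    root = let (r , r-inner , _) = inner-with-neighbour in r , r-inner

  r = proj₁ root
  r-inner : inner T r ≡ true
  r-inner = proj₂ root

  state-root : State₁ (∅ ◂ r)
  state-root = place₁ state-∅ r x₀ 1≤m₂ refl (≤-trans 1≤D (≤-trans (n≤1+n D) (≤-reflexive (sym dx₀))))
    (large₁ state-∅ (λ _ ()) (P₀ r)) (λ _ ()) (λ _ ())
    (λ v b _ → ∸-mono {suc D} {weigh (not (B v)) (suc D)}
      (≤-reflexive (cong (λ z → weigh (not z) (suc D)) (sym b))) (weigh≤ (v == x₀) 1))
    (remaining≤D (∅ ◂ r) r)
    where
    dx₀ : weigh (not (B x₀)) (suc D) ≡ suc D
    dx₀ = cong (λ z → weigh z (suc D)) (proj₂ outside-B)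

  record InnerEmbedded : Set where
    field
      S       : FinSet k
      state   : State₁ S
      S⊆inner : S ⊆ inner T
      inner⊆S : inner T ⊆ S

  Growth : FinSet k → Set
  Growth S = ∃ λ u → S u ≡ false × State₁ (S ◂ u) × (S ◂ u) ⊆ inner T × ConnectedOn T (S ◂ u)

  attach : ∀ {S} → State₁ S → S ⊆ inner T → ConnectedOn T S →
    (∃ λ p → ∃ λ u → S p ≡ true × S u ≡ false × inner T u ≡ true × adj T p u ≡ true) → Growth S
  attach {S} st S⊆ con (p , u , p∈S , u∉S , u-inner , pu) = u , u∉S
    , place-child₁ st u p 1≤m₂ u∉S p∈S pu (λ s s∈S su → unique-attachment T acyclic u∉S (con s p s∈S p∈S) su pu)
        (large₁ st S⊆ (P₀ u)) (remaining≤D (S ◂ u) u)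
    , ◂-⊆ S⊆ u-inner , connectedOn-◂ T con p∈S pu

  attach-missing : ∀ {S : FinSet k} → S r ≡ true → (∃ λ t → inner T t ≡ true × S t ≡ false) →
    ∃ λ p → ∃ λ u → S p ≡ true × S u ≡ false × inner T u ≡ true × adj T p u ≡ true
  attach-missing {S} r∈S (t , t-inner , t∉S) = attach-inner {S} {r} {t} r∈S (connected r t) t-inner t∉S

  finished-or-growth : ∀ {S} → State₁ S → S ⊆ inner T → S r ≡ true → ConnectedOn T S → inner T ⊆ S ⊎ Growth S
  finished-or-growth {S} st S⊆ r∈S con =
    [ (λ missing → inj₂ (attach st S⊆ con (attach-missing r∈S missing))) , inj₁ ]′ (missing-or-⊆ (inner T) S)

  embed-inner : ∀ fuel {S} → State₁ S → S ⊆ inner T → S r ≡ true → ConnectedOn T S → k ≤ fuel + # S → InnerEmbedded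
  continue : ∀ fuel {S} → State₁ S → S ⊆ inner T → S r ≡ true → k ≤ fuel + # S →
    inner T ⊆ S ⊎ Growth S → InnerEmbedded

  embed-inner fuel st S⊆ r∈S con le = continue fuel st S⊆ r∈S le (finished-or-growth st S⊆ r∈S con)

  continue fuel {S} st S⊆ r∈S le (inj₁ done) = record { S = S ; state = st ; S⊆inner = S⊆ ; inner⊆S = done }
  continue zero {S} st S⊆ r∈S le (inj₂ (u , u∉S , _)) =
    ⊥-elim (<⇒≱ (≤-trans (≤-reflexive (sym (#-◂ {X = S} u∉S))) (#≤n (S ◂ u))) le)
  continue (suc fuel) {S} st S⊆ r∈S le (inj₂ (u , u∉S , st′ , S⊆′ , con′)) =
    embed-inner fuel {S ◂ u} st′ S⊆′ (◂-old {X = S} r∈S) con′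
      (subst (k ≤_) (trans (sym (+-suc fuel (# S))) (cong (fuel +_) (sym (#-◂ {X = S} u∉S)))) le)

  opaque
    inner-embedded : InnerEmbedded
    inner-embedded = embed-inner k state-root (◂-⊆ {X = ∅} (λ _ ()) r-inner) (==-refl r)
      (connectedOn-single T r) (m≤m+n k _)

  contains : Contains H T
  contains = Completion.contains H T connected 3≤L k+m₁
    (≤-trans (s≤s z≤n) (≤-trans (*-monoʳ-≤ 24 6≤m₂) (≤-trans 24m₂≤24Dm₂ 24Dm₂≤n)))
    ex₂ W W-sparse S S⊆inner inner⊆S (St₁.φ state) (St₁.inj state) (St₁.hom state) (St₁.d state) (St₁.dem state)
    small-hall P₀ P₀⊆parent #P₀ (λ t p → subst (λ c → avail c (St₁.φ state t) ≡ true) p (St₁.cls state t (P⊆S t p)))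
    where
    open InnerEmbedded inner-embedded
    P⊆S : P₀ ⊆ S
    P⊆S t p = inner⊆S t (proj₁ (∧-elim {inner T t} (P₀⊆parent t p)))
    small-hall : ∀ Z → # Z ≤ 2 * m₂ →
      weight (St₁.d state) Z ≤ # (Γ (λ x y → adj H x y ∧ not (image S (St₁.φ state) y)) Z)
    small-hall Z le = ≤-trans (St₁.hall state true Z le)
      (#-mono (Γ-mono {R = free₁ true S (St₁.φ state)} {X = Z} {Z} (λ _ p → p) λ x y _ p →
        let (e , _ , _ , i) = free₁-elim {true} {S} {St₁.φ state} p in ∧-intro e (not-intro i)))

theorem3p4 : Σ ℕ λ N → ∀ (n m₁ m₂ D : ℕ) → N ≤ n → 1 ≤ m₁ → 1 ≤ m₂ → 1 ≤ D →
    LogCond m₁ m₂ n → 16 * D * m₂ ≤ n →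
    (H : Graph n) → WeakExpander H m₁ (ceilDiv n (32 * D ∸ 1)) → WeakExpander H m₂ m₂ →
    (T : Graph (suc (n ∸ m₁))) → TreeIn𝒯 (n ∸ m₁) D T → 24 * D * m₂ ≤ leaves T →
    Contains H T
theorem3p4 = 4 , λ n m₁ m₂ D 4≤n 1≤m₁ 1≤m₂ 1≤D log 16Dm₂≤n H ex₁ ex₂ T ((connected , acyclic) , maxdeg) many →
  let 6m₁<m₂ = LogCond⇒6m₁<m₂ {m₁} {m₂} 4≤n log
      m₂≤n = ≤-trans (m≤n*m m₂ (16 * D) {{m*n≢0 16 D {{_}} {{>-nonZero 1≤D}}}}) 16Dm₂≤n
      m₁≤n = ≤-trans (m≤n*m m₁ 6) (≤-trans (<⇒≤ 6m₁<m₂) m₂≤n)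
  in Proof.contains 1≤m₁ (<⇒≤ 6m₁<m₂) (cong suc (m∸n+n≡m m₁≤n)) H ex₁ ex₂ (LogCond⇒ {m₁} {m₂} log)
       T connected acyclic maxdeg 1≤D many
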